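{- Let $q$ be a prime power, let $n\ge k\ge1$ be integers, and let $\mathcal{C}$ be a minimal nondegenerate $[n,k,d]_q$ code. If $\mathcal{C}$ is not constant-weight, then $$n-k+1>\frac{n(q^k-q^{k-1})}{q^k-1}$$ and $$d\le\left\lfloor\frac{n(q-1)q^{k-2}\,[n-1-q(k-1)]}{n(q^{k-1}-1)-(k-1)(q^k-1)}\right\rfloor .$$ In particular, $q^{k-2}n^2-Bn+C\ge 0$, where $$B=q^{k-2}+(k-1)(2q^{k-1}-1)+\frac{q^{k-1}-1}{q-1},\qquad C=(k-1)^2(q^k-1)+\frac{(k-1)(q^k-1)}{q-1}.$$
   Context: For $v\in\mathbb{F}_q^n$, the support is $\sigma(v)=\{i : v_i\ne 0\}$ and the weight is $\omega(v)=|\sigma(v)|$. An $[n,k,d]_q$ code is an $\mathbb{F}_q$-linear subspace $\mathcal{C}\subseteq\mathbb{F}_q^n$ of dimension $k\ge1$ with minimum distance $d=\min\{\omega(c): c\in\mathcal{C},\ c\neq 0\}$. It is nondegenerate if there is no coordinate $i$ with $c_i=0$ for all $c\in\mathcal{C}$. It is constant-weight if all its nonzero codewords have the same weight. A nonzero codeword $c\in\mathcal{C}$ is minimal if every $c'\in\mathcal{C}$ with $\sigma(c')\subseteq\sigma(c)$ is a scalar multiple of $c$; the code is minimal if all its nonzero codewords are minimal. -}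

module Defs where

open import Algebra.Apartness.Bundles using (HeytingField; HeytingCommutativeRing)
open import Algebra.Bundles using (CommutativeRing)
import Algebra.Definitions.RawMonoid as RawMonoidDefs
open import Data.Fin.Base using (Fin)
open import Data.Fin.Properties using () renaming (_≟_ to _≟ᶠ_)
open import Data.Fin.Subset using (Subset; ∣_∣; _⊆_)
open import Data.Integer.Base as ℤ using (+_; 1ℤ)
open import Data.Nat.Base as ℕ using (ℕ; _∸_; _^_; _≤_; _<_; NonZero)
open import Data.Nat.Primality using (Prime; prime⇒nonTrivial)
import Data.Nat.Properties as ℕ
open import Data.Product.Base using (∃₂; ∃-syntax; Σ-syntax; _×_; _,_)
open import Data.Rational.Base as ℚ using (ℚ; _/_; 1ℚ)
open import Data.Vec.Base using (tabulate)
open import Data.Vec.Functional using (Vector)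
import Data.Vec.Functional.Relation.Binary.Equality.Setoid as VectorEquality
open import Function.Bundles using (Bijection)
open import Level using (suc; _⊔_)
open import Relation.Binary.Definitions using (Decidable; _Respects_)
open import Relation.Binary.PropositionalEquality as ≡ using (_≡_)
open import Relation.Nullary.Decidable using (does; ¬?; via-injection)
open import Relation.Nullary.Negation using (¬_)
open import Relation.Unary using (Pred; _∈_)

PrimePower : Pred ℕ _
PrimePower q = ∃₂ λ p e → Prime p × 1 ≤ e × q ≡ p ^ e

-- A Heyting field is automatically nontrivial (1# is apart from 0#).  Since a
-- finite carrier has decidable equality, x # y is here equivalent to ¬ x ≈ y.
record FiniteField (q : ℕ) c ℓ₁ ℓ₂ : Set (suc (c ⊔ ℓ₁ ⊔ ℓ₂)) where
  field
    heytingField : HeytingField c ℓ₁ ℓ₂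

  open HeytingField heytingField public

  commutativeRing : CommutativeRing c ℓ₁
  commutativeRing = HeytingCommutativeRing.commutativeRing heytingCommutativeRing

  field
    enumeration : Bijection setoid (≡.setoid (Fin q))

  infix 4 _≟_

  _≟_ : Decidable _≈_
  _≟_ = via-injection (Bijection.injection enumeration) _≟ᶠ_

module Coding {q c ℓ₁ ℓ₂} (F : FiniteField q c ℓ₁ ℓ₂) where
  open FiniteField F
  open CommutativeRing commutativeRing using (+-rawMonoid)
  open RawMonoidDefs +-rawMonoid using (sum)
  open VectorEquality setoid public using (_≋_)

  module _ {n : ℕ} where

    infixl 6 _+ᵛ_
    infixl 7 _*ᵛ_

    0ᵛ : Vector Carrier n
    0ᵛ _ = 0#

    _+ᵛ_ : Vector Carrier n → Vector Carrier n → Vector Carrier n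
    (u +ᵛ v) i = u i + v i

    _*ᵛ_ : Carrier → Vector Carrier n → Vector Carrier n
    (a *ᵛ v) i = a * v i

    linearCombination : ∀ {k} → Vector Carrier k → Vector (Vector Carrier n) k → Vector Carrier n
    linearCombination a b i = sum (λ j → a j * b j i)

    σ : Vector Carrier n → Subset n
    σ v = tabulate λ i → does (¬? (v i ≟ 0#))

    ω : Vector Carrier n → ℕ
    ω v = ∣ σ v ∣

    module _ {p} (C : Pred (Vector Carrier n) p) where

      record IsSubspace : Set (c ⊔ ℓ₁ ⊔ p) where
        field
          respects : C Respects _≋_
          0-closed : 0ᵛ ∈ C
          +-closed : ∀ {u v} → u ∈ C → v ∈ C → u +ᵛ v ∈ C
          *-closed : ∀ a {v} → v ∈ C → a *ᵛ v ∈ C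

      record IsBasis {k} (b : Vector (Vector Carrier n) k) : Set (c ⊔ ℓ₁ ⊔ p) where
        field
          members     : ∀ j → b j ∈ C
          independent : ∀ a → linearCombination a b ≋ 0ᵛ → ∀ j → a j ≈ 0#
          spanning    : ∀ {v} → v ∈ C → ∃[ a ] v ≋ linearCombination a b

      HasDimension : ℕ → Set (c ⊔ ℓ₁ ⊔ p)
      HasDimension k = Σ[ b ∈ Vector (Vector Carrier n) k ] IsBasis b

      record IsMinimumDistance (d : ℕ) : Set (c ⊔ ℓ₁ ⊔ p) where
        field
          attained   : ∃[ v ] v ∈ C × ¬ v ≋ 0ᵛ × ω v ≡ d
          lowerBound : ∀ {v} → v ∈ C → ¬ v ≋ 0ᵛ → d ≤ ω v

      record IsCode (k d : ℕ) : Set (c ⊔ ℓ₁ ⊔ p) where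
        field
          isSubspace      : IsSubspace
          1≤k             : 1 ≤ k
          dimension       : HasDimension k
          minimumDistance : IsMinimumDistance d

      Nondegenerate : Set (c ⊔ ℓ₁ ⊔ p)
      Nondegenerate = ¬ (∃[ i ] ∀ v → v ∈ C → v i ≈ 0#)

      ConstantWeight : Set (c ⊔ ℓ₁ ⊔ p)
      ConstantWeight = ∀ {u v} → u ∈ C → v ∈ C → ¬ u ≋ 0ᵛ → ¬ v ≋ 0ᵛ → ω u ≡ ω v

      record IsMinimalCodeword (v : Vector Carrier n) : Set (c ⊔ ℓ₁ ⊔ p) where
        field
          codeword : v ∈ C
          nonzero  : ¬ v ≋ 0ᵛ
          minimal  : ∀ {u} → u ∈ C → σ u ⊆ σ v → ∃[ a ] u ≋ a *ᵛ v

      IsMinimalCode : Set (c ⊔ ℓ₁ ⊔ p)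
      IsMinimalCode = ∀ {v} → v ∈ C → ¬ v ≋ 0ᵛ → IsMinimalCodeword v

primePower⇒1<q : ∀ {q} → PrimePower q → 1 < q
primePower⇒1<q (p , e , p-prime , 1≤e , ≡.refl) =
  ℕ.^-monoʳ-< p (ℕ.nonTrivial⇒n>1 p {{prime⇒nonTrivial p-prime}}) 1≤e

-- The truncated subtractions below are exact since q ≥ 2 and k ≥ 1.
module Bounds {q} (q-primePower : PrimePower q) (n : ℕ) {k} (1≤k : 1 ≤ k) where

  private
    1<q : 1 < q
    1<q = primePower⇒1<q q-primePower

    instance
      q≢0 : NonZero q
      q≢0 = ℕ.>-nonZero (ℕ.<⇒≤ 1<q)

      q²≢0 : NonZero (q ^ 2)
      q²≢0 = ℕ.m^n≢0 q 2

      q∸1≢0 : NonZero (q ∸ 1)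
      q∸1≢0 = ℕ.>-nonZero (ℕ.m<n⇒0<n∸m 1<q)

      qᵏ∸1≢0 : NonZero (q ^ k ∸ 1)
      qᵏ∸1≢0 = ℕ.>-nonZero (ℕ.m<n⇒0<n∸m (ℕ.^-monoʳ-< q 1<q 1≤k))

  n′ q′ k-1 qᵏ qᵏ⁻¹ : ℚ
  n′   = + n / 1
  q′   = + q / 1
  k-1  = + (k ∸ 1) / 1
  qᵏ   = + (q ^ k) / 1
  qᵏ⁻¹ = + (q ^ (k ∸ 1)) / 1

  -- Not q ^ (k ∸ 2): for k = 1 this must be 1/q.
  qᵏ⁻² : ℚ
  qᵏ⁻² = + (q ^ k) / (q ^ 2)

  averageWeight : ℚ
  averageWeight = (+ n ℤ.* (+ (q ^ k) ℤ.- + (q ^ (k ∸ 1)))) / (q ^ k ∸ 1)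

  distanceNumerator distanceDenominator : ℚ
  distanceNumerator   = n′ ℚ.* (q′ ℚ.- 1ℚ) ℚ.* qᵏ⁻² ℚ.* (n′ ℚ.- 1ℚ ℚ.- q′ ℚ.* k-1)
  distanceDenominator = n′ ℚ.* (qᵏ⁻¹ ℚ.- 1ℚ) ℚ.- k-1 ℚ.* (qᵏ ℚ.- 1ℚ)

  B C : ℚ
  B = qᵏ⁻² ℚ.+ k-1 ℚ.* (+ 2 / 1 ℚ.* qᵏ⁻¹ ℚ.- 1ℚ) ℚ.+ (+ (q ^ (k ∸ 1)) ℤ.- 1ℤ) / (q ∸ 1)
  C = k-1 ℚ.* k-1 ℚ.* (qᵏ ℚ.- 1ℚ) ℚ.+ (+ (k ∸ 1) ℤ.* (+ (q ^ k) ℤ.- 1ℤ)) / (q ∸ 1)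

{-# OPTIONS --safe #-}
-- Write W = n - k + 1. For a minimal code every nonzero codeword c satisfies
-- (k - 1)(q - 1) + 1 ≤ ω(c) ≤ W.
--
-- Upper bound: otherwise a nonzero codeword vanishes off σ(c) and at one point
-- of σ(c), so it is not a multiple of c.
--
-- Lower bound: fix i₀ ∈ σ(c). A nonzero codeword u with u_{i₀} = 0 agrees with
-- c somewhere on σ(c), as otherwise σ(c) ⊆ σ(u - c). So the ω(c) - 1 equations
-- u_i = c_i (i ∈ σ(c), i ≠ i₀) and the q - 1 equations u_{i₀} = s (s ≠ 0) define
-- affine hyperplanes of 𝔽_q^k that cover everything except the origin. There are
-- at least k(q - 1) of these (Jamison): the sum over 𝔽_q^k of a polynomial of
-- degree below k(q - 1) is zero.
--
-- Counting zeros of functionals gives Σ ω(c) = n(q - 1)q^{k-1} and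
-- q Σ ω(c)² ≥ n²(q - 1)²q^{k-1} + n(q - 1)q^{k-1}. If the weights are not all
-- equal, the mean weight is below W. The distance bound is Σ (W - ω)(ω - d) ≥ 0
-- over the nonzero codewords, and the quadratic inequality is the distance bound
-- together with d ≥ (k - 1)(q - 1) + 1.

module Submission where

open import Defs
open import Algebra.Bundles using (CommutativeMonoid; CommutativeRing)
import Algebra.Properties.CommutativeMonoid.Sum as CommutativeMonoidSum
import Algebra.Properties.CommutativeSemiring.Exp as CommutativeSemiringExp
import Algebra.Properties.Group as GroupProperties
import Algebra.Properties.Ring as RingProperties
import Algebra.Properties.Semiring.Exp as SemiringExp
import Algebra.Properties.Semiring.Sum as SemiringSum
import Algebra.Solver.Ring.NaturalCoefficients.Default as NaturalSolver
open import Data.Bool.Base using (Bool; if_then_else_; true; false)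
open import Data.Fin.Base as Fin using (Fin; zero; suc; funToFin; finToFun; combine; punchIn)
import Data.Fin.Properties as Fin
open import Data.Fin.Subset as Subset using (Subset; ∣_∣; _⊆_; ∁; inside; outside)
import Data.Fin.Subset.Properties as Subset
open import Data.Integer.Base as ℤ using (ℤ; +_; +≤+; +<+; 0ℤ; 1ℤ)
import Data.Integer.DivMod as ℤ
import Data.Integer.Properties as ℤ
import Data.Integer.Solver as ℤSolver
open import Data.List.Base as List using (List; []; _∷_; length; _++_; allFin)
import Data.List.Membership.Propositional as List
import Data.List.Membership.Propositional.Properties as List
import Data.List.Properties as List
open import Data.List.Relation.Unary.All as All using (All; []; _∷_)
import Data.List.Relation.Unary.All.Properties as All
open import Data.List.Relation.Unary.Any as Any using (Any; here; there)
import Data.List.Relation.Unary.Any.Properties as Any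
open import Data.Nat.Base as ℕ using (ℕ; zero; suc; _≤_; _<_; z≤n; s≤s)
import Data.Nat.Properties as ℕ
import Data.Nat.Solver as ℕSolver
open import Data.Product.Base using (Σ-syntax; ∃-syntax; _×_; _,_; proj₁; proj₂)
open import Data.Rational.Base as ℚ using (ℚ; 0ℚ; 1ℚ; _/_; _÷_; toℚᵘ; floor)
import Data.Rational.Properties as ℚ
import Data.Rational.Solver as ℚSolver
open import Data.Rational.Unnormalised.Base as ℚᵘ using (mkℚᵘ; *≡*; *≤*; *<*)
import Data.Rational.Unnormalised.Properties as ℚᵘ
open import Data.Vec.Base as Vec using (Vec; []; _∷_; tabulate)
open import Data.Vec.Functional using (Vector; removeAt; updateAt)
import Data.Vec.Functional.Relation.Binary.Equality.Setoid as VectorEquality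
import Data.Vec.Properties as Vec
open import Function.Base using (_∘_; const)
open import Function.Bundles using (Inverse)
import Function.Construct.Composition as Composition
import Function.Construct.Symmetry as Symmetry
open import Function.Properties.Bijection using (Bijection⇒Inverse)
open import Level using (_⊔_)
open import Relation.Binary.Bundles using (Setoid)
open import Relation.Binary.Core using (_Preserves_⟶_)
open import Relation.Binary.Definitions using (Decidable)
open import Relation.Binary.PropositionalEquality as ≡ using (_≡_; _≢_)
open import Relation.Nullary.Decidable as Dec using (Dec; yes; no; does; ¬?; decidable-stable)
open import Relation.Nullary.Negation using (¬_; contradiction)
open import Relation.Unary using (Pred; _∈_)

-- Finite sums and enumerations

module _ {c ℓ} (M : CommutativeMonoid c ℓ) where
  open CommutativeMonoid M
  open CommutativeMonoidSum M
  open import Relation.Binary.Reasoning.Setoid setoid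

  sum-supportedAt : ∀ {n} (t : Vector Carrier n) i → (∀ j → j ≢ i → t j ≈ ε) → sum t ≈ t i
  sum-supportedAt {suc n} t i t≈ε = begin
    sum t                     ≈⟨ sum-remove t ⟩
    t i ∙ sum (removeAt t i)  ≈⟨ ∙-congˡ (sum-cong-≋ λ j → t≈ε _ (Fin.punchInᵢ≢i i j)) ⟩
    t i ∙ sum {n} (const ε)   ≈⟨ ∙-congˡ (sum-replicate-zero n) ⟩
    t i ∙ ε                   ≈⟨ identityʳ _ ⟩
    t i                       ∎

  -- Conjugating `φ` by `enum` gives a permutation of `Fin N`. This is how sums over a whole vector
  -- space become invariant under translation and scaling.
  sum-reindex : ∀ {a s N} {S : Setoid a s} (enum : Inverse S (≡.setoid (Fin N))) (φ : Inverse S S)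
    {f : Setoid.Carrier S → Carrier} → f Preserves Setoid._≈_ S ⟶ _≈_ →
    sum (f ∘ Inverse.from enum) ≈ sum (f ∘ Inverse.to φ ∘ Inverse.from enum)
  sum-reindex {N = N} enum φ f-cong = trans (sum-permute _ π)
    (sum-cong-≋ {N} λ i → f-cong (Inverse.strictlyInverseʳ enum _))
    where π = Composition.inverse (Symmetry.inverse enum) (Composition.inverse φ enum)

funToFin-cong : ∀ {m n} {f g : Fin m → Fin n} → (∀ i → f i ≡ g i) → funToFin f ≡ funToFin g
funToFin-cong {zero}  f≗g = ≡.refl
funToFin-cong {suc m} f≗g = ≡.cong₂ combine (f≗g zero) (funToFin-cong (f≗g ∘ suc))

-- The indices of the entries are read as the base-`N` digits of a number. Vectors are functions, so
-- the inverse laws hold only up to pointwise equality, whence the setoid `≋-setoid`.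
Vector-enumeration : ∀ {a s N} {S : Setoid a s} → Inverse S (≡.setoid (Fin N)) →
  ∀ k → Inverse (VectorEquality.≋-setoid S k) (≡.setoid (Fin (N ℕ.^ k)))
Vector-enumeration {N = N} {S} enum k = record
  { to        = λ v → funToFin (to ∘ v)
  ; from      = λ i → from ∘ finToFun i
  ; to-cong   = λ u≋v → funToFin-cong (to-cong ∘ u≋v)
  ; from-cong = λ { ≡.refl _ → Setoid.refl S }
  ; inverse   =
      (λ {i} v≋ → ≡.trans (funToFin-cong λ j → inverseˡ (v≋ j)) (Fin.funToFin-finToFin {k} {N} i))
    , (λ { ≡.refl j → inverseʳ (Fin.finToFun-funToFin _ j) })
  }
  where open Inverse enum

module ∑ℕ = SemiringSum ℕ.+-*-semiring

∑-mono : ∀ {n} {f g : Vector ℕ n} → (∀ i → f i ≤ g i) → ∑ℕ.sum f ≤ ∑ℕ.sum g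
∑-mono {zero}  f≤g = z≤n
∑-mono {suc n} f≤g = ℕ.+-mono-≤ (f≤g zero) (∑-mono (f≤g ∘ suc))

∑-const : ∀ n c → ∑ℕ.sum {n} (const c) ≡ n ℕ.* c
∑-const zero    c = ≡.refl
∑-const (suc n) c = ≡.cong (c ℕ.+_) (∑-const n c)

-- The equality case behind `average<`: weights bounded by W whose sum is as large as this bound
-- allows must all equal W.
∑-mono-tight : ∀ {n} {f g : Vector ℕ n} → (∀ i → f i ≤ g i) → ∑ℕ.sum g ≤ ∑ℕ.sum f → ∀ i → f i ≡ g i
∑-mono-tight {suc n} {f} {g} f≤g ∑g≤∑f zero = ℕ.≤-antisym (f≤g zero)
  (ℕ.+-cancelʳ-≤ (∑ℕ.sum (g ∘ suc)) _ _ (ℕ.≤-trans ∑g≤∑f (ℕ.+-monoʳ-≤ (f zero) (∑-mono (f≤g ∘ suc)))))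
∑-mono-tight {suc n} {f} {g} f≤g ∑g≤∑f (suc i) = ∑-mono-tight (f≤g ∘ suc)
  (ℕ.+-cancelˡ-≤ (g zero) _ _ (ℕ.≤-trans ∑g≤∑f (ℕ.+-monoˡ-≤ _ (f≤g zero)))) i

-- Meant for one row of a double sum over pairs of coordinates, where the diagonal entry exceeds the
-- common bound `x` by a surplus `y`.
∑-lowerBound : ∀ {n} {f : Vector ℕ n} i {x y} → (∀ j → x ≤ f j) → x ℕ.+ y ≤ f i → n ℕ.* x ℕ.+ y ≤ ∑ℕ.sum f
∑-lowerBound {suc n} {f} i {x} {y} x≤f x+y≤fᵢ = begin
  x ℕ.+ n ℕ.* x ℕ.+ y                 ≡⟨ ℕ.+-assoc x _ y ⟩
  x ℕ.+ (n ℕ.* x ℕ.+ y)               ≡⟨ ≡.cong (x ℕ.+_) (ℕ.+-comm _ y) ⟩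
  x ℕ.+ (y ℕ.+ n ℕ.* x)               ≡⟨ ℕ.+-assoc x y _ ⟨
  x ℕ.+ y ℕ.+ n ℕ.* x                 ≡⟨ ≡.cong (x ℕ.+ y ℕ.+_) (∑-const n x) ⟨
  x ℕ.+ y ℕ.+ ∑ℕ.sum {n} (const x)    ≤⟨ ℕ.+-mono-≤ x+y≤fᵢ (∑-mono {n} (λ j → x≤f (punchIn i j))) ⟩
  f i ℕ.+ ∑ℕ.sum (removeAt f i)       ≡⟨ ∑ℕ.sum-remove f ⟨
  ∑ℕ.sum f                            ∎
  where open ℕ.≤-Reasoning

𝟙 : ∀ {p} {P : Set p} → Dec P → ℕ
𝟙 P? = if does P? then 1 else 0

𝟙-cong : ∀ {p q} {P : Set p} {Q : Set q} (P? : Dec P) (Q? : Dec Q) → (P → Q) → (Q → P) → 𝟙 P? ≡ 𝟙 Q?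
𝟙-cong (yes p) (yes q) _   _   = ≡.refl
𝟙-cong (yes p) (no ¬q) P⇒Q _   = contradiction (P⇒Q p) ¬q
𝟙-cong (no ¬p) (yes q) _   Q⇒P = contradiction (Q⇒P q) ¬p
𝟙-cong (no ¬p) (no ¬q) _   _   = ≡.refl

𝟙-true : ∀ {p} {P : Set p} (P? : Dec P) → P → 𝟙 P? ≡ 1
𝟙-true P? p = ≡.cong (if_then 1 else 0) (Dec.dec-true P? p)

𝟙-false : ∀ {p} {P : Set p} (P? : Dec P) → ¬ P → 𝟙 P? ≡ 0
𝟙-false P? ¬p = ≡.cong (if_then 1 else 0) (Dec.dec-false P? ¬p)

-- Finite fields

-- Apartness is replaced by the negation of a decidable equality, so that being nonzero can be
-- tested and yields an inverse directly.
record IsFiniteField {c ℓ} (R : CommutativeRing c ℓ) (q : ℕ) : Set (c ⊔ ℓ) where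
  open CommutativeRing R

  infix 4 _≟_

  field
    finite     : Inverse setoid (≡.setoid (Fin q))
    _≟_        : Decidable _≈_
    1≉0        : ¬ 1# ≈ 0#
    invertible : ∀ {x} → ¬ x ≈ 0# → ∃[ y ] x * y ≈ 1#

module _ {q c ℓ₁ ℓ₂} (F : FiniteField q c ℓ₁ ℓ₂) where
  open FiniteField F using (commutativeRing; enumeration; _≟_; tight; #⇒invertible; invertible⇒#)
  open CommutativeRing commutativeRing
  open GroupProperties +-group using () renaming (ε⁻¹≈ε to -0≈0)

  isFiniteField : IsFiniteField commutativeRing q
  isFiniteField = record
    { finite     = finite
    ; _≟_        = _≟_
    ; 1≉0        = λ 1≈0 → proj₂ (tight 1# 0#) 1≈0
        (invertible⇒# (1# , trans (*-identityˡ _) (x-0≈x 1#) , trans (*-identityʳ _) (x-0≈x 1#)))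
    ; invertible = invertible
    }
    where
    finite : Inverse setoid (≡.setoid (Fin q))
    finite = Bijection⇒Inverse enumeration

    x-0≈x : ∀ x → x - 0# ≈ x
    x-0≈x x = trans (+-congˡ -0≈0) (+-identityʳ x)

    -- Being nonzero is only known to be a doubly negated apartness from 0#, but
    -- invertibility is stable because an inverse can be searched for.
    invertible : ∀ {x} → ¬ x ≈ 0# → ∃[ y ] x * y ≈ 1#
    invertible {x} x≉0 = decidable-stable
      (Dec.map′ (λ (i , p) → Inverse.from finite i , p)
        (λ (y , xy≈1) → Inverse.to finite y , trans (*-congˡ (Inverse.strictlyInverseʳ finite y)) xy≈1)
        (Fin.any? λ i → x * Inverse.from finite i ≟ 1#))
      λ ∄y → x≉0 (proj₁ (tight x 0#) λ x#0 →
        let y , _ , eq = #⇒invertible x#0 in ∄y (y , trans (*-congʳ (sym (x-0≈x x))) eq))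

module FiniteFieldProperties {c ℓ r} {R : CommutativeRing c ℓ} (isFiniteField : IsFiniteField R (suc r)) where
  open CommutativeRing R hiding (zero)
  open IsFiniteField isFiniteField public
  open CommutativeMonoidSum *-commutativeMonoid public using () renaming
    (sum to ∏; sum-cong-≋ to ∏-cong; ∑-distrib-+ to ∏-distrib-*; sum-replicate-zero to ∏-replicate-1)
  open SemiringSum semiring public
  open SemiringExp semiring public using (_^_; ^-congˡ)
  open GroupProperties +-group public using () renaming
    ( x∙y⁻¹≈ε⇒x≈y to x-y≈0⇒x≈y; ⁻¹-injective to -‿injective; ε⁻¹≈ε to -0≈0
    ; ∙-cancelˡ to +-cancelˡ; identityˡ-unique to +-identityˡ-unique)
  open RingProperties ring using ([y-z]x≈yx-zx; x≈y⇒x∙y⁻¹≈ε)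
  open VectorEquality setoid public using (_≋_; ≋-setoid)

  open Inverse finite public using () renaming (to to index; from to element)

  index-injective : ∀ {x y} → index x ≡ index y → x ≈ y
  index-injective eq = trans (sym (Inverse.strictlyInverseʳ finite _))
    (trans (Inverse.from-cong finite eq) (Inverse.strictlyInverseʳ finite _))

  module _ where
    open CommutativeSemiringExp commutativeSemiring using (^-distrib-*)
    open NaturalSolver commutativeSemiring using (solve; con; _:+_; _:*_; _:=_)
    open import Relation.Binary.Reasoning.Setoid setoid

    x*z≈y*z⇒z≈0 : ∀ {x y z} → ¬ x ≈ y → x * z ≈ y * z → z ≈ 0#
    x*z≈y*z⇒z≈0 {x} {y} {z} x≉y xz≈yz =
      let w , [x-y]w≈1 = invertible (x≉y ∘ x-y≈0⇒x≈y x y) in begin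
      z                    ≈⟨ *-identityˡ z ⟨
      1# * z               ≈⟨ *-congʳ (trans (*-comm w (x - y)) [x-y]w≈1) ⟨
      w * (x - y) * z      ≈⟨ *-assoc w (x - y) z ⟩
      w * ((x - y) * z)    ≈⟨ *-congˡ ([y-z]x≈yx-zx z x y) ⟩
      w * (x * z - y * z)  ≈⟨ *-congˡ (x≈y⇒x∙y⁻¹≈ε xz≈yz) ⟩
      w * 0#               ≈⟨ zeroʳ w ⟩
      0#                   ∎

    x*y≉0 : ∀ {x y} → ¬ x ≈ 0# → ¬ y ≈ 0# → ¬ x * y ≈ 0#
    x*y≉0 x≉0 y≉0 xy≈0 = y≉0 (x*z≈y*z⇒z≈0 x≉0 (trans xy≈0 (sym (zeroˡ _))))

    -x≈0⇒x≈0 : ∀ {x} → - x ≈ 0# → x ≈ 0#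
    -x≈0⇒x≈0 -x≈0 = -‿injective (trans -x≈0 (sym -0≈0))

    -- Univariate polynomials and their roots

    eval : ∀ {n} → Vec Carrier n → Carrier → Carrier
    eval []      x = 0#
    eval (c ∷ p) x = c + x * eval p x

    -- Synthetic division by X - y, constant term first: the coefficients are the Horner values at
    -- `y` of the successive tails.
    quotient : ∀ {n} → Vec Carrier (suc n) → Carrier → Vec Carrier n
    quotient (c ∷ [])    y = []
    quotient (c ∷ d ∷ p) y = eval (d ∷ p) y ∷ quotient (d ∷ p) y

    -- p(x) - p(y) = (x - y) Q(x), without subtraction.
    eval-quotient : ∀ {n} (p : Vec Carrier (suc n)) x y →
      eval p x + y * eval (quotient p y) x ≈ x * eval (quotient p y) x + eval p y
    eval-quotient (c ∷ []) x y = solve 3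
      (λ c x y → (c :+ x :* con 0) :+ y :* con 0 := x :* con 0 :+ (c :+ y :* con 0)) refl c x y
    eval-quotient (c ∷ d ∷ p) x y = begin
      (c + x * f) + y * (e + x * h)  ≈⟨ solve 6 (λ c x y e f h →
        (c :+ x :* f) :+ y :* (e :+ x :* h) := c :+ y :* e :+ x :* (f :+ y :* h)) refl c x y e f h ⟩
      c + y * e + x * (f + y * h)    ≈⟨ +-congˡ (*-congˡ (eval-quotient (d ∷ p) x y)) ⟩
      c + y * e + x * (x * h + e)    ≈⟨ solve 5 (λ c x y e h →
        c :+ y :* e :+ x :* (x :* h :+ e) := x :* (e :+ x :* h) :+ (c :+ y :* e)) refl c x y e h ⟩
      x * (e + x * h) + (c + y * e)  ∎
      where
      e = eval (d ∷ p) y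
      f = eval (d ∷ p) x
      h = eval (quotient (d ∷ p) y) x

    -- A polynomial with `n` coefficients has degree below `n`. Dividing by X - x₀ removes one
    -- coefficient and one root, and the other points remain roots of the quotient because they
    -- differ from x₀.
    roots-bound : ∀ {n} (p : Vec Carrier n) (x : Vector Carrier n) →
      (∀ {i j} → x i ≈ x j → i ≡ j) → (∀ i → eval p (x i) ≈ 0#) → ∀ y → eval p y ≈ 0#
    roots-bound [] x x-inj roots y = refl
    roots-bound p@(_ ∷ _) x x-inj roots y = begin
      eval p y                     ≈⟨ +-identityʳ _ ⟨
      eval p y + 0#                ≈⟨ +-congˡ (zeroʳ x₀) ⟨
      eval p y + x₀ * 0#           ≈⟨ +-congˡ (*-congˡ (Q≈0 y)) ⟨
      eval p y + x₀ * eval Q y     ≈⟨ eval-quotient p y x₀ ⟩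
      y * eval Q y + eval p x₀     ≈⟨ +-cong (trans (*-congˡ (Q≈0 y)) (zeroʳ y)) (roots zero) ⟩
      0# + 0#                      ≈⟨ +-identityˡ 0# ⟩
      0#                           ∎
      where
      x₀ = x zero
      Q = quotient p x₀
      Q≈0 : ∀ y → eval Q y ≈ 0#
      Q≈0 = roots-bound Q (x ∘ suc) (Fin.suc-injective ∘ x-inj) λ i →
        x*z≈y*z⇒z≈0 (λ eq → contradiction (x-inj eq) λ ()) (begin
          x₀ * eval Q (x (suc i))                       ≈⟨ +-identityˡ _ ⟨
          0# + x₀ * eval Q (x (suc i))                  ≈⟨ +-congʳ (roots (suc i)) ⟨
          eval p (x (suc i)) + x₀ * eval Q (x (suc i))  ≈⟨ eval-quotient p (x (suc i)) x₀ ⟩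
          x (suc i) * eval Q (x (suc i)) + eval p x₀    ≈⟨ +-congˡ (roots zero) ⟩
          x (suc i) * eval Q (x (suc i)) + 0#           ≈⟨ +-identityʳ _ ⟩
          x (suc i) * eval Q (x (suc i))                ∎)

    nonzeroElement : Fin r → Carrier
    nonzeroElement i = element (punchIn (index 0#) i)

    index-element : ∀ i → index (element i) ≡ i
    index-element = Inverse.strictlyInverseˡ finite

    nonzeroElement≉0 : ∀ i → ¬ nonzeroElement i ≈ 0#
    nonzeroElement≉0 i eq = Fin.punchInᵢ≢i (index 0#) i
      (≡.trans (≡.sym (index-element _)) (Inverse.to-cong finite eq))

    nonzeroElement-injective : ∀ {i j} → nonzeroElement i ≈ nonzeroElement j → i ≡ j
    nonzeroElement-injective eq = Fin.punchIn-injective (index 0#) _ _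
      (≡.trans (≡.sym (index-element _)) (≡.trans (Inverse.to-cong finite eq) (index-element _)))

    nonzeroElement-surjective : ∀ {x} → ¬ x ≈ 0# → ∃[ i ] nonzeroElement i ≈ x
    nonzeroElement-surjective {x} x≉0 =
      Fin.punchOut 0≢x , Inverse.inverseʳ finite (Fin.punchIn-punchOut 0≢x)
      where
      0≢x : index 0# ≢ index x
      0≢x eq = x≉0 (sym (index-injective eq))

    -- If x^(e+1) = 1 for every nonzero x, then X^(e+1) - 1, which has e + 2 coefficients and at
    -- least e + 2 distinct roots, vanishes everywhere by `roots-bound`; but its value at 0 is -1.
    nontrivialPower : ∀ e → suc e < r → ∃[ x ] ¬ x ≈ 0# × ¬ x ^ suc e ≈ 1#
    nontrivialPower e 1+e<r with Fin.any? (λ i → ¬? (nonzeroElement i ^ suc e ≟ 1#))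
    ... | yes (i , x^e≉1) = nonzeroElement i , nonzeroElement≉0 i , x^e≉1
    ... | no  ∄i = contradiction
      (-x≈0⇒x≈0 (begin
        - 1#                       ≈⟨ +-identityʳ _ ⟨
        - 1# + 0#                  ≈⟨ +-congˡ (zeroˡ _) ⟨
        eval (- 1# ∷ x^ e) 0#      ≈⟨ roots-bound (- 1# ∷ x^ e) (nonzeroElement ∘ embed) embed-injective root 0# ⟩
        0#                         ∎))
      1≉0
      where
      embed : Fin (suc (suc e)) → Fin r
      embed i = Fin.inject≤ i 1+e<r

      embed-injective : ∀ {i j} → nonzeroElement (embed i) ≈ nonzeroElement (embed j) → i ≡ j
      embed-injective = Fin.inject≤-injective 1+e<r 1+e<r _ _ ∘ nonzeroElement-injective

      x^_ : ∀ n → Vec Carrier (suc n)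
      x^ zero  = 1# ∷ []
      x^ suc n = 0# ∷ x^ n

      eval-x^ : ∀ n y → eval (x^ n) y ≈ y ^ n
      eval-x^ zero    y = trans (+-congˡ (zeroʳ y)) (+-identityʳ 1#)
      eval-x^ (suc n) y = trans (+-identityˡ _) (*-congˡ (eval-x^ n y))

      root : ∀ i → eval (- 1# ∷ x^ e) (nonzeroElement (embed i)) ≈ 0#
      root i = begin
        - 1# + x * eval (x^ e) x  ≈⟨ +-congˡ (*-congˡ (eval-x^ e x)) ⟩
        - 1# + x ^ suc e          ≈⟨ +-congˡ (decidable-stable (_ ≟ _) λ x^e≉1 → ∄i (embed i , x^e≉1)) ⟩
        - 1# + 1#                 ≈⟨ -‿inverseˡ 1# ⟩
        0#                        ∎
        where x = nonzeroElement (embed i)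

    -- Jamison's theorem

    V-enum : ∀ k → Inverse (≋-setoid k) (≡.setoid (Fin (suc r ℕ.^ k)))
    V-enum = Vector-enumeration finite

    point : ∀ {k} → Fin (suc r ℕ.^ k) → Vector Carrier k
    point {k} = Inverse.from (V-enum k)

    pointwise : ∀ {k} → (Fin k → Inverse setoid setoid) → Inverse (≋-setoid k) (≋-setoid k)
    pointwise φ = record
      { to        = λ v j → Inverse.to (φ j) (v j)
      ; from      = λ v j → Inverse.from (φ j) (v j)
      ; to-cong   = λ u≋v j → Inverse.to-cong (φ j) (u≋v j)
      ; from-cong = λ u≋v j → Inverse.from-cong (φ j) (u≋v j)
      ; inverse   = (λ eq j → Inverse.inverseˡ (φ j) (eq j)) , (λ eq j → Inverse.inverseʳ (φ j) (eq j))
      }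

    translation : Carrier → Inverse setoid setoid
    translation t = record
      { to        = _+ t
      ; from      = _- t
      ; to-cong   = +-congʳ
      ; from-cong = +-congʳ
      ; inverse   = (λ eq → trans (+-congʳ eq) (//-rightDividesˡ t _))
                  , (λ eq → trans (+-congʳ eq) (//-rightDividesʳ t _))
      }
      where open GroupProperties +-group using (//-rightDividesˡ; //-rightDividesʳ)

    scaling : ∀ {x y} → x * y ≈ 1# → Inverse setoid setoid
    scaling {x} {y} xy≈1 = record
      { to        = x *_
      ; from      = y *_
      ; to-cong   = *-congˡ
      ; from-cong = *-congˡ
      ; inverse   = (λ eq → trans (*-congˡ eq) (cancel xy≈1 _))
                  , (λ eq → trans (*-congˡ eq) (cancel (trans (*-comm y x) xy≈1) _))
      }
      where
      cancel : ∀ {x y} → x * y ≈ 1# → ∀ z → x * (y * z) ≈ z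
      cancel {x} {y} xy≈1 z = trans (sym (*-assoc x y z)) (trans (*-congʳ xy≈1) (*-identityˡ z))

    -- The value off `i` is a parameter because 0 there gives a translation along the i-th axis, and
    -- 1 there gives a scaling of the i-th variable alone.
    spike : ∀ {k} → Fin k → Carrier → Carrier → Vector Carrier k
    spike i x y j = if does (i Fin.≟ j) then x else y

    spike-at : ∀ {k} (i : Fin k) x y → spike i x y i ≡ x
    spike-at i x y = ≡.cong (if_then x else y) (Dec.dec-true (i Fin.≟ i) ≡.refl)

    spike-off : ∀ {k} {i j : Fin k} x y → j ≢ i → spike i x y j ≡ y
    spike-off {i = i} {j} x y j≢i = ≡.cong (if_then x else y) (Dec.dec-false (i Fin.≟ j) (j≢i ∘ ≡.sym))

    monomial : ∀ {k} → (Fin k → ℕ) → Vector Carrier k → Carrier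
    monomial e a = ∏ λ i → a i ^ e i

    monomial-cong : ∀ {k} (e : Fin k → ℕ) {a b} → a ≋ b → monomial e a ≈ monomial e b
    monomial-cong e a≋b = ∏-cong λ i → ^-congˡ (e i) (a≋b i)

    1^n≈1 : ∀ n → 1# ^ n ≈ 1#
    1^n≈1 zero    = refl
    1^n≈1 (suc n) = trans (*-identityˡ _) (1^n≈1 n)

    -- A bijection of the space acting on the i-th variable alone is enough, so the sum is never
    -- factored over the coordinates. The bound on `e i` provides, when `e i` is positive, a scalar
    -- whose power `e i` is not 1.
    ∑-monomial≈0 : ∀ {k} (e : Fin k → ℕ) i → e i < r → sum {suc r ℕ.^ k} (monomial e ∘ point) ≈ 0#
    ∑-monomial≈0 {k} e i eᵢ<r = go (e i) ≡.refl
      where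
      N = suc r ℕ.^ k
      T = sum {N} (monomial e ∘ point)

      go : ∀ m → e i ≡ m → T ≈ 0#
      -- The monomial does not involve the i-th variable, so it is the difference
      -- between a i * monomial e a and its translate along that variable.
      go zero eᵢ≡0 = sym (+-cancelˡ _ _ _ (begin
        sum {N} (h ∘ point) + 0#                              ≈⟨ +-identityʳ _ ⟩
        sum {N} (h ∘ point)                                   ≈⟨ sum-reindex +-commutativeMonoid (V-enum k) τ h-cong ⟩
        sum {N} (h ∘ Inverse.to τ ∘ point)                    ≈⟨ sum-cong-≋ {N} (h∘τ ∘ point) ⟩
        sum {N} (λ m → h (point m) + monomial e (point m))    ≈⟨ ∑-distrib-+ {N} (h ∘ point) (monomial e ∘ point) ⟩
        sum {N} (h ∘ point) + T                               ∎))
        where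
        τ = pointwise (translation ∘ spike i 1# 0#)

        h : Vector Carrier k → Carrier
        h a = a i * monomial e a

        h-cong : h Preserves _≋_ ⟶ _≈_
        h-cong a≋b = *-cong (a≋b i) (monomial-cong e a≋b)

        τ-invariant : ∀ a j → Inverse.to τ a j ^ e j ≈ a j ^ e j
        τ-invariant a j with j Fin.≟ i
        ... | yes ≡.refl rewrite eᵢ≡0 = refl
        ... | no  j≢i rewrite spike-off 1# 0# j≢i = ^-congˡ (e j) (+-identityʳ (a j))

        h∘τ : ∀ a → h (Inverse.to τ a) ≈ h a + monomial e a
        h∘τ a = begin
          (a i + spike i 1# 0# i) * monomial e (Inverse.to τ a)  ≡⟨ ≡.cong (λ x → (a i + x) * monomial e (Inverse.to τ a)) (spike-at i 1# 0#) ⟩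
          (a i + 1#) * monomial e (Inverse.to τ a)               ≈⟨ *-congˡ (∏-cong (τ-invariant a)) ⟩
          (a i + 1#) * monomial e a                              ≈⟨ distribʳ _ _ _ ⟩
          h a + 1# * monomial e a                                ≈⟨ +-congˡ (*-identityˡ _) ⟩
          h a + monomial e a                                     ∎

      -- Scaling the i-th variable by x multiplies the sum by x ^ e i.
      go (suc m) eᵢ≡1+m =
        let x , x≉0 , x^e≉1 = nontrivialPower m (≡.subst (_< r) eᵢ≡1+m eᵢ<r)
            y , xy≈1        = invertible x≉0
        in x*z≈y*z⇒z≈0 x^e≉1 (trans (sym (scaled xy≈1)) (sym (*-identityˡ T)))
        where
        spike-inverse : ∀ {x y} → x * y ≈ 1# → ∀ j → spike i x 1# j * spike i y 1# j ≈ 1#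
        spike-inverse xy≈1 j with does (i Fin.≟ j)
        ... | true  = xy≈1
        ... | false = *-identityˡ 1#

        scaled : ∀ {x y} → x * y ≈ 1# → T ≈ x ^ suc m * T
        scaled {x} xy≈1 = begin
          T                                                       ≈⟨ sum-reindex +-commutativeMonoid (V-enum k) φ (monomial-cong e) ⟩
          sum {N} (monomial e ∘ Inverse.to φ ∘ point)             ≈⟨ sum-cong-≋ {N} (homogeneous ∘ point) ⟩
          sum {N} (λ m′ → x ^ suc m * monomial e (point m′))      ≈⟨ *-distribˡ-sum {N} (x ^ suc m) (monomial e ∘ point) ⟨
          x ^ suc m * T                                           ∎
          where
          φ = pointwise (scaling ∘ spike-inverse xy≈1)

          off : ∀ j → j ≢ i → spike i x 1# j ^ e j ≈ 1#
          off j j≢i rewrite spike-off x 1# j≢i = 1^n≈1 (e j)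

          homogeneous : ∀ a → monomial e (Inverse.to φ a) ≈ x ^ suc m * monomial e a
          homogeneous a = begin
            ∏ (λ j → (spike i x 1# j * a j) ^ e j)           ≈⟨ ∏-cong (λ j → ^-distrib-* (spike i x 1# j) (a j) (e j)) ⟩
            ∏ (λ j → spike i x 1# j ^ e j * a j ^ e j)       ≈⟨ ∏-distrib-* (λ j → spike i x 1# j ^ e j) _ ⟩
            ∏ (λ j → spike i x 1# j ^ e j) * monomial e a    ≈⟨ *-congʳ (sum-supportedAt *-commutativeMonoid _ i off) ⟩
            spike i x 1# i ^ e i * monomial e a              ≡⟨ ≡.cong₂ (λ y n → y ^ n * monomial e a) (spike-at i x 1#) eᵢ≡1+m ⟩
            x ^ suc m * monomial e a                         ∎

    increment : ∀ {k} → (Fin k → ℕ) → Fin k → Fin k → ℕ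
    increment e i = updateAt e i suc

    monomial-increment : ∀ {k} (e : Fin k → ℕ) i a → monomial (increment e i) a ≈ a i * monomial e a
    monomial-increment e zero    a = *-assoc _ _ _
    monomial-increment e (suc i) a = trans (*-congˡ (monomial-increment (e ∘ suc) i (a ∘ suc)))
      (solve 3 (λ x y z → x :* (y :* z) := y :* (x :* z)) refl _ _ _)

    ∑-increment : ∀ {k} (e : Fin k → ℕ) i → ∑ℕ.sum (increment e i) ≡ suc (∑ℕ.sum e)
    ∑-increment e zero    = ≡.refl
    ∑-increment e (suc i) = ≡.trans (≡.cong (e zero ℕ.+_) (∑-increment (e ∘ suc) i)) (ℕ.+-suc (e zero) _)

    ∑<k*r⇒∃<r : ∀ {k} (e : Fin k → ℕ) → ∑ℕ.sum e < k ℕ.* r → ∃[ i ] e i < r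
    ∑<k*r⇒∃<r {suc k} e e<kr with e zero ℕ.<? r
    ... | yes e₀<r = zero , e₀<r
    ... | no  e₀≮r =
      let i , eᵢ<r = ∑<k*r⇒∃<r (e ∘ suc) (ℕ.≰⇒> λ kr≤ →
            ℕ.<⇒≱ e<kr (ℕ.+-mono-≤ (ℕ.≮⇒≥ e₀≮r) kr≤))
      in suc i , eᵢ<r

    AffineForm : ℕ → Set c
    AffineForm k = Vector Carrier k × Carrier

    ⟦_⟧ : ∀ {k} → AffineForm k → Vector Carrier k → Carrier
    ⟦ l , t ⟧ a = sum (λ j → a j * l j) + t

    ⟦_⟧-cong : ∀ {k} (L : AffineForm k) {a b} → a ≋ b → ⟦ L ⟧ a ≈ ⟦ L ⟧ b
    ⟦ L ⟧-cong a≋b = +-congʳ (sum-cong-≋ λ j → *-congʳ (a≋b j))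

    ∏ᴸ : ∀ {k} → List (AffineForm k) → Vector Carrier k → Carrier
    ∏ᴸ []       a = 1#
    ∏ᴸ (L ∷ Ls) a = ⟦ L ⟧ a * ∏ᴸ Ls a

    ∏ᴸ-cong : ∀ {k} (Ls : List (AffineForm k)) {a b} → a ≋ b → ∏ᴸ Ls a ≈ ∏ᴸ Ls b
    ∏ᴸ-cong []       a≋b = refl
    ∏ᴸ-cong (L ∷ Ls) a≋b = *-cong (⟦ L ⟧-cong a≋b) (∏ᴸ-cong Ls a≋b)

    ∏ᴸ≈0 : ∀ {k} {Ls : List (AffineForm k)} {a} → Any (λ L → ⟦ L ⟧ a ≈ 0#) Ls → ∏ᴸ Ls a ≈ 0#
    ∏ᴸ≈0 (here L≈0)  = trans (*-congʳ L≈0) (zeroˡ _)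
    ∏ᴸ≈0 (there any) = trans (*-congˡ (∏ᴸ≈0 any)) (zeroʳ _)

    ∏ᴸ≉0 : ∀ {k} {Ls : List (AffineForm k)} {a} → All (λ L → ¬ ⟦ L ⟧ a ≈ 0#) Ls → ¬ ∏ᴸ Ls a ≈ 0#
    ∏ᴸ≉0 []          = 1≉0
    ∏ᴸ≉0 (L≉0 ∷ all) = x*y≉0 L≉0 (∏ᴸ≉0 all)

    -- Induction on the list takes the place of multivariate polynomials. Expanding the first form,
    -- each linear term raises one exponent by 1 and the constant term raises none, so the degree
    -- plus the number of remaining forms does not grow. With no form left, the exponents sum to
    -- less than k r and one of them is below r.
    ∑-monomial*∏ᴸ≈0 : ∀ {k} (Ls : List (AffineForm k)) e → ∑ℕ.sum e ℕ.+ length Ls < k ℕ.* r →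
      sum {suc r ℕ.^ k} (λ m → monomial e (point m) * ∏ᴸ Ls (point m)) ≈ 0#
    ∑-monomial*∏ᴸ≈0 {k} [] e deg< =
      let i , eᵢ<r = ∑<k*r⇒∃<r e (≡.subst (_< k ℕ.* r) (ℕ.+-identityʳ _) deg<) in
      trans (sum-cong-≋ {suc r ℕ.^ k} λ m → *-identityʳ _) (∑-monomial≈0 e i eᵢ<r)
    ∑-monomial*∏ᴸ≈0 {k} ((l , t) ∷ Ls) e deg< = begin
      sum {N} (λ m → X e m * ((sum (λ j → point m j * l j) + t) * P m))    ≈⟨ sum-cong-≋ {N} expand ⟩
      sum {N} (λ m → sum (λ j → l j * Y j m) + t * Z m)                     ≈⟨ ∑-distrib-+ {N} _ (λ m → t * Z m) ⟩
      sum {N} (λ m → sum (λ j → l j * Y j m)) + sum {N} (λ m → t * Z m)    ≈⟨ +-cong (∑-comm {N} (λ m j → l j * Y j m)) (sym (*-distribˡ-sum {N} t Z)) ⟩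
      sum (λ j → sum {N} (λ m → l j * Y j m)) + t * sum {N} Z               ≈⟨ +-cong (sum-cong-≋ λ j →
          trans (sym (*-distribˡ-sum {N} (l j) (Y j))) (trans (*-congˡ (IHʸ j)) (zeroʳ _)))
        (trans (*-congˡ IHᶻ) (zeroʳ t)) ⟩
      sum {k} (const 0#) + 0#                                                ≈⟨ +-identityʳ _ ⟩
      sum {k} (const 0#)                                                     ≈⟨ sum-replicate-zero k ⟩
      0#                                                                     ∎
      where
      N = suc r ℕ.^ k
      X : (Fin k → ℕ) → Fin N → Carrier
      X e m = monomial e (point m)
      P : Fin N → Carrier
      P m = ∏ᴸ Ls (point m)
      Y : Fin k → Fin N → Carrier
      Y j m = X (increment e j) m * P m
      Z : Fin N → Carrier
      Z m = X e m * P m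
      deg<′ : suc (∑ℕ.sum e ℕ.+ length Ls) < k ℕ.* r
      deg<′ = ≡.subst (_< k ℕ.* r) (ℕ.+-suc _ _) deg<
      IHʸ : ∀ j → sum {N} (Y j) ≈ 0#
      IHʸ j = ∑-monomial*∏ᴸ≈0 Ls (increment e j)
        (≡.subst (λ s → s ℕ.+ length Ls < k ℕ.* r) (≡.sym (∑-increment e j)) deg<′)
      IHᶻ : sum {N} Z ≈ 0#
      IHᶻ = ∑-monomial*∏ᴸ≈0 Ls e (ℕ.<⇒≤ deg<′)
      expand : ∀ m → X e m * ((sum (λ j → point m j * l j) + t) * P m) ≈ sum (λ j → l j * Y j m) + t * Z m
      expand m = begin
        X e m * ((sum (λ j → point m j * l j) + t) * P m)       ≈⟨ solve 4 (λ x s t p →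
          x :* ((s :+ t) :* p) := s :* (x :* p) :+ t :* (x :* p)) refl (X e m) _ t (P m) ⟩
        sum (λ j → point m j * l j) * (X e m * P m) + t * Z m   ≈⟨ +-congʳ (*-distribʳ-sum {k} _ _) ⟩
        sum (λ j → point m j * l j * (X e m * P m)) + t * Z m   ≈⟨ +-congʳ (sum-cong-≋ λ j → begin
          point m j * l j * (X e m * P m)    ≈⟨ solve 4 (λ a l x p → a :* l :* (x :* p) := l :* (a :* x :* p)) refl (point m j) (l j) (X e m) (P m) ⟩
          l j * (point m j * X e m * P m)    ≈⟨ *-congˡ (*-congʳ (monomial-increment e j (point m))) ⟨
          l j * Y j m                        ∎) ⟩
        sum (λ j → l j * Y j m) + t * Z m                       ∎

    -- Jamison's bound: the product of the forms is a nonzero multiple of the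
    -- indicator function of the origin, whose sum over the space does not vanish.
    affineForms-cover : ∀ {k} (Ls : List (AffineForm k)) →
      (∀ a → ¬ a ≋ const 0# → Any (λ L → ⟦ L ⟧ a ≈ 0#) Ls) →
      All (λ L → ¬ ⟦ L ⟧ (const 0#) ≈ 0#) Ls →
      k ℕ.* r ≤ length Ls
    affineForms-cover {k} Ls cover avoid = ℕ.≮⇒≥ λ len< → x*y≉0 monomial≉0 (∏ᴸ≉0 avoid) (begin
      f (const 0#)                           ≈⟨ f-cong (Inverse.strictlyInverseʳ (V-enum k) (const 0#)) ⟨
      f (point origin)                       ≈⟨ sum-supportedAt +-commutativeMonoid (f ∘ point) origin off ⟨
      sum {suc r ℕ.^ k} (f ∘ point)          ≈⟨ ∑-monomial*∏ᴸ≈0 Ls (const 0)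
                                                  (≡.subst (λ s → s ℕ.+ length Ls < k ℕ.* r) (≡.sym (∑ℕ.sum-replicate-zero k)) len<) ⟩
      0#                                     ∎)
      where
      origin = Inverse.to (V-enum k) (const 0#)
      f : Vector Carrier k → Carrier
      -- With all exponents 0 the monomial is 1; it gives `f` the shape summed in `∑-monomial*∏ᴸ≈0`.
      f a = monomial (const 0) a * ∏ᴸ Ls a
      f-cong : f Preserves _≋_ ⟶ _≈_
      f-cong a≋b = *-cong (monomial-cong (const 0) a≋b) (∏ᴸ-cong Ls a≋b)
      off : ∀ m → m ≢ origin → f (point m) ≈ 0#
      off m m≢origin = trans (*-congˡ (∏ᴸ≈0 (cover (point m) λ point≋0 → m≢origin
        (≡.sym (Inverse.inverseˡ (V-enum k) {m} (λ j → sym (point≋0 j))))))) (zeroʳ _)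
      monomial≉0 : ¬ monomial {k} (const 0) (const 0#) ≈ 0#
      monomial≉0 eq = 1≉0 (trans (sym (∏-replicate-1 k)) eq)

  -- Moments of the weight distribution

  private
    q = suc r

  module _ {k M} (φ : Vector Carrier k → Fin M) (φ-cong : φ Preserves _≋_ ⟶ _≡_) where

    fibre : Fin M → ℕ
    fibre y = ∑ℕ.sum {q ℕ.^ k} λ m → 𝟙 (φ (point m) Fin.≟ y)

    ∑-fibre : ∑ℕ.sum fibre ≡ q ℕ.^ k
    ∑-fibre = begin
      ∑ℕ.sum fibre                                                              ≡⟨ ∑ℕ.∑-comm {M} {q ℕ.^ k} (λ y m → 𝟙 (φ (point m) Fin.≟ y)) ⟩
      (∑ℕ.sum {q ℕ.^ k} λ m → ∑ℕ.sum {M} λ y → 𝟙 (φ (point m) Fin.≟ y))       ≡⟨ ∑ℕ.sum-cong-≗ {q ℕ.^ k} (λ m → ≡.trans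
          (sum-supportedAt ℕ.+-0-commutativeMonoid {M} _ (φ (point m)) λ y y≢ → 𝟙-false (_ Fin.≟ y) (y≢ ∘ ≡.sym))
          (𝟙-true (φ (point m) Fin.≟ φ (point m)) ≡.refl)) ⟩
      ∑ℕ.sum {q ℕ.^ k} (const 1)                                               ≡⟨ ∑-const (q ℕ.^ k) 1 ⟩
      q ℕ.^ k ℕ.* 1                                                            ≡⟨ ℕ.*-identityʳ _ ⟩
      q ℕ.^ k                                                                  ∎
      where open ≡.≡-Reasoning

    -- The target of `φ` is a bare finite set. These two hypotheses carry what is used of a
    -- homomorphism: translation by b takes the kernel onto the fibre over φ(b), so every nonempty
    -- fibre has the size of the kernel.
    module _ (shift : ∀ a b → φ (λ j → a j + b j) ≡ φ b → φ a ≡ φ (const 0#))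
             (unshift : ∀ a b → φ a ≡ φ (const 0#) → φ (λ j → a j + b j) ≡ φ b) where

      kernelSize : ℕ
      kernelSize = fibre (φ (const 0#))

      fibre-φ : ∀ b → fibre (φ b) ≡ kernelSize
      fibre-φ b = ≡.trans
        (sum-reindex ℕ.+-0-commutativeMonoid (V-enum k) (pointwise (translation ∘ b)) {λ a → 𝟙 (φ a Fin.≟ φ b)}
          λ u≋v → ≡.cong (λ y → 𝟙 (y Fin.≟ φ b)) (φ-cong u≋v))
        (∑ℕ.sum-cong-≗ {q ℕ.^ k} λ m → 𝟙-cong (_ Fin.≟ _) (_ Fin.≟ _) (shift (point m) b) (unshift (point m) b))

      fibre≤kernelSize : ∀ y → fibre y ≤ kernelSize
      fibre≤kernelSize y with Fin.any? (λ m → φ (point m) Fin.≟ y)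
      ... | yes (m , ≡.refl) = ℕ.≤-reflexive (fibre-φ (point m))
      ... | no  ∄m = ≡.subst (_≤ kernelSize) (≡.sym (≡.trans
        (∑ℕ.sum-cong-≗ {q ℕ.^ k} λ m → 𝟙-false (_ Fin.≟ y) λ eq → ∄m (m , eq))
        (∑ℕ.sum-replicate-zero (q ℕ.^ k)))) z≤n

      -- The image may be smaller than `Fin M`, for instance for two proportional functionals, so
      -- the kernel may be larger than q^k / M and only an inequality holds.
      kernelSize-lowerBound : q ℕ.^ k ≤ M ℕ.* kernelSize
      kernelSize-lowerBound = ≡.subst₂ _≤_ ∑-fibre (∑-const M kernelSize) (∑-mono fibre≤kernelSize)

      kernelSize-surjective : (∀ y → ∃[ b ] φ b ≡ y) → M ℕ.* kernelSize ≡ q ℕ.^ k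
      kernelSize-surjective surj = ≡.trans (≡.sym (∑-const M kernelSize))
        (≡.trans (∑ℕ.sum-cong-≗ {M} λ y → let b , φb≡y = surj y in
          ≡.trans (≡.sym (fibre-φ b)) (≡.cong fibre φb≡y)) ∑-fibre)

  -- Additivity makes the fibres cosets of the kernel; surjectivity expresses that the functional is
  -- nonzero.
  record IsFunctional {k} (g : Vector Carrier k → Carrier) : Set (c ⊔ ℓ) where
    field
      cong       : g Preserves _≋_ ⟶ _≈_
      additive   : ∀ a b → g (λ j → a j + b j) ≈ g a + g b
      surjective : ∀ x → ∃[ a ] g a ≈ x

    g[0]≈0 : g (const 0#) ≈ 0#
    g[0]≈0 = +-identityˡ-unique _ _ (trans (sym (additive _ _)) (cong λ _ → +-identityˡ 0#))

    shift : ∀ {a b} → g (λ j → a j + b j) ≈ g b → g a ≈ 0#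
    shift eq = +-identityˡ-unique _ _ (trans (sym (additive _ _)) eq)

    unshift : ∀ {a b} → g a ≈ 0# → g (λ j → a j + b j) ≈ g b
    unshift ga≈0 = trans (additive _ _) (trans (+-congʳ ga≈0) (+-identityˡ _))

  isZero nonzero : Carrier → ℕ
  isZero  x = 𝟙 (x ≟ 0#)
  nonzero x = 𝟙 (¬? (x ≟ 0#))

  nonzero+isZero : ∀ x → nonzero x ℕ.+ isZero x ≡ 1
  nonzero+isZero x with does (x ≟ 0#)
  ... | true  = ≡.refl
  ... | false = ≡.refl

  module _ {m : ℕ} where
    private
      k = suc m
      Q = q ℕ.^ m
      V = Vector Carrier k

    ∑ᵛ : (V → ℕ) → ℕ
    ∑ᵛ f = ∑ℕ.sum {q ℕ.^ k} (f ∘ point)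

    ∑ᵛ-isZero : ∀ {g} → IsFunctional g → ∑ᵛ (isZero ∘ g) ≡ Q
    ∑ᵛ-isZero {g} isF = ℕ.*-cancelˡ-≡ _ Q q (≡.trans (≡.cong (q ℕ.*_)
      (∑ℕ.sum-cong-≗ {q ℕ.^ k} λ i → 𝟙-cong (_ ≟ _) (_ Fin.≟ _) ⇒ ⇐))
      (kernelSize-surjective (index ∘ g) (index-cong ∘ cong)
        (λ a b eq → ⇒ (shift (index-injective eq)))
        (λ a b eq → index-cong (unshift (⇐ eq)))
        λ y → let a , ga≈ = surjective (element y) in a , Inverse.inverseˡ finite ga≈))
      where
      open IsFunctional isF
      index-cong = Inverse.to-cong finite
      ⇒ : ∀ {a} → g a ≈ 0# → index (g a) ≡ index (g (const 0#))
      ⇒ eq = index-cong (trans eq (sym g[0]≈0))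
      ⇐ : ∀ {a} → index (g a) ≡ index (g (const 0#)) → g a ≈ 0#
      ⇐ eq = trans (index-injective eq) g[0]≈0

    -- The pair (g, h) takes at most q² values, so its kernel has at least q^(k-2) elements. The
    -- bound is stated multiplied by q because q^(k-2) is not a natural number for k = 1.
    ∑ᵛ-isZero² : ∀ {g h} → IsFunctional g → IsFunctional h → Q ≤ q ℕ.* ∑ᵛ (λ a → isZero (g a) ℕ.* isZero (h a))
    ∑ᵛ-isZero² {g} {h} G H = ℕ.*-cancelˡ-≤ q (≡.subst (q ℕ.* Q ≤_)
      (≡.trans (≡.cong (q ℕ.* q ℕ.*_) (∑ℕ.sum-cong-≗ {q ℕ.^ k} (product ∘ point))) (ℕ.*-assoc q q _))
      (kernelSize-lowerBound φ φ-cong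
        (λ a b eq → let eq₁ , eq₂ = φ-injective eq in
          φ≡ (trans (G.shift eq₁) (sym G.g[0]≈0)) (trans (H.shift eq₂) (sym H.g[0]≈0)))
        (λ a b eq → let eq₁ , eq₂ = φ-injective eq in
          φ≡ (G.unshift (trans eq₁ G.g[0]≈0)) (H.unshift (trans eq₂ H.g[0]≈0)))))
      where
      module G = IsFunctional G
      module H = IsFunctional H
      index-cong = Inverse.to-cong finite
      φ : V → Fin (q ℕ.* q)
      φ a = combine (index (g a)) (index (h a))
      φ≡ : ∀ {a b} → g a ≈ g b → h a ≈ h b → φ a ≡ φ b
      φ≡ eq₁ eq₂ = ≡.cong₂ combine (index-cong eq₁) (index-cong eq₂)
      φ-cong : φ Preserves _≋_ ⟶ _≡_
      φ-cong a≋b = φ≡ (G.cong a≋b) (H.cong a≋b)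
      φ-injective : ∀ {a b} → φ a ≡ φ b → g a ≈ g b × h a ≈ h b
      φ-injective eq = let eq₁ , eq₂ = Fin.combine-injective _ _ _ _ eq in index-injective eq₁ , index-injective eq₂
      product : ∀ a → 𝟙 (φ a Fin.≟ φ (const 0#)) ≡ isZero (g a) ℕ.* isZero (h a)
      product a with g a ≟ 0# | h a ≟ 0#
      ... | yes ga≈0 | yes ha≈0 = 𝟙-true (_ Fin.≟ _) (φ≡ (trans ga≈0 (sym G.g[0]≈0)) (trans ha≈0 (sym H.g[0]≈0)))
      ... | yes _    | no  ha≉0 = 𝟙-false (_ Fin.≟ _) λ eq → ha≉0 (trans (proj₂ (φ-injective eq)) H.g[0]≈0)
      ... | no  ga≉0 | _        = 𝟙-false (_ Fin.≟ _) λ eq → ga≉0 (trans (proj₁ (φ-injective eq)) G.g[0]≈0)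

    ∑ᵛ-nonzero : ∀ {g} → IsFunctional g → ∑ᵛ (nonzero ∘ g) ≡ r ℕ.* Q
    ∑ᵛ-nonzero {g} G = ℕ.+-cancelʳ-≡ Q _ _ (begin
      ∑ᵛ (nonzero ∘ g) ℕ.+ Q                          ≡⟨ ≡.cong (∑ᵛ (nonzero ∘ g) ℕ.+_) (∑ᵛ-isZero G) ⟨
      ∑ᵛ (nonzero ∘ g) ℕ.+ ∑ᵛ (isZero ∘ g)             ≡⟨ ∑ℕ.∑-distrib-+ {q ℕ.^ k} (nonzero ∘ g ∘ point) _ ⟨
      ∑ᵛ (λ a → nonzero (g a) ℕ.+ isZero (g a))        ≡⟨ ∑ℕ.sum-cong-≗ {q ℕ.^ k} (nonzero+isZero ∘ g ∘ point) ⟩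
      ∑ᵛ (const 1)                                    ≡⟨ ∑-const (q ℕ.^ k) 1 ⟩
      q ℕ.^ k ℕ.* 1                                   ≡⟨ ℕ.*-identityʳ _ ⟩
      Q ℕ.+ r ℕ.* Q                                   ≡⟨ ℕ.+-comm Q _ ⟩
      r ℕ.* Q ℕ.+ Q                                   ∎)
      where open ≡.≡-Reasoning

    -- Inclusion-exclusion: the vectors where both functionals are nonzero number q^k - 2 q^(k-1)
    -- plus the size of the common kernel. The term q (Q + Q) is added on both sides to avoid
    -- subtraction.
    ∑ᵛ-nonzero² : ∀ {g h} → IsFunctional g → IsFunctional h →
      r ℕ.* r ℕ.* Q ≤ q ℕ.* ∑ᵛ (λ a → nonzero (g a) ℕ.* nonzero (h a))
    ∑ᵛ-nonzero² {g} {h} G H = ℕ.+-cancelʳ-≤ (q ℕ.* (Q ℕ.+ Q)) _ _ (begin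
      r ℕ.* r ℕ.* Q ℕ.+ q ℕ.* (Q ℕ.+ Q)          ≡⟨ solve 2 (λ r Q →
        r :* r :* Q :+ (con 1 :+ r) :* (Q :+ Q) := (con 1 :+ r) :* ((con 1 :+ r) :* Q) :+ Q) ≡.refl r Q ⟩
      q ℕ.* (q ℕ.* Q) ℕ.+ Q                      ≤⟨ ℕ.+-monoʳ-≤ _ (∑ᵛ-isZero² G H) ⟩
      q ℕ.* (q ℕ.* Q) ℕ.+ q ℕ.* ZZ               ≡⟨ ℕ.*-distribˡ-+ q (q ℕ.* Q) ZZ ⟨
      q ℕ.* (q ℕ.* Q ℕ.+ ZZ)                     ≡⟨ ≡.cong (q ℕ.*_) inclusion-exclusion ⟨
      q ℕ.* (NN ℕ.+ (Q ℕ.+ Q))                   ≡⟨ ℕ.*-distribˡ-+ q NN _ ⟩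
      q ℕ.* NN ℕ.+ q ℕ.* (Q ℕ.+ Q)               ∎)
      where
      open ℕSolver.+-*-Solver
      open ℕ.≤-Reasoning
      N = q ℕ.^ k
      NN = ∑ᵛ (λ a → nonzero (g a) ℕ.* nonzero (h a))
      ZZ = ∑ᵛ (λ a → isZero (g a) ℕ.* isZero (h a))
      pointwise-identity : ∀ x y → nonzero x ℕ.* nonzero y ℕ.+ (isZero x ℕ.+ isZero y) ≡ 1 ℕ.+ isZero x ℕ.* isZero y
      pointwise-identity x y with does (x ≟ 0#) | does (y ≟ 0#)
      ... | true  | true  = ≡.refl
      ... | true  | false = ≡.refl
      ... | false | true  = ≡.refl
      ... | false | false = ≡.refl
      inclusion-exclusion : NN ℕ.+ (Q ℕ.+ Q) ≡ N ℕ.+ ZZ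
      inclusion-exclusion = begin-equality
        NN ℕ.+ (Q ℕ.+ Q)                                    ≡⟨ ≡.cong₂ (λ x y → NN ℕ.+ (x ℕ.+ y)) (∑ᵛ-isZero G) (∑ᵛ-isZero H) ⟨
        NN ℕ.+ (∑ᵛ (isZero ∘ g) ℕ.+ ∑ᵛ (isZero ∘ h))        ≡⟨ ≡.cong (NN ℕ.+_) (∑ℕ.∑-distrib-+ {N} (isZero ∘ g ∘ point) _) ⟨
        NN ℕ.+ ∑ᵛ (λ a → isZero (g a) ℕ.+ isZero (h a))     ≡⟨ ∑ℕ.∑-distrib-+ {N} (λ i → nonzero (g (point i)) ℕ.* nonzero (h (point i))) _ ⟨
        ∑ᵛ (λ a → nonzero (g a) ℕ.* nonzero (h a) ℕ.+ (isZero (g a) ℕ.+ isZero (h a)))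
                                                            ≡⟨ ∑ℕ.sum-cong-≗ {N} (λ i → pointwise-identity (g (point i)) (h (point i))) ⟩
        ∑ᵛ (λ a → 1 ℕ.+ isZero (g a) ℕ.* isZero (h a))      ≡⟨ ∑ℕ.∑-distrib-+ {N} (const 1) _ ⟩
        ∑ℕ.sum {N} (const 1) ℕ.+ ZZ                         ≡⟨ ≡.cong (ℕ._+ ZZ) (≡.trans (∑-const N 1) (ℕ.*-identityʳ N)) ⟩
        N ℕ.+ ZZ                                            ∎

    module _ {n} (g : Fin n → V → Carrier) where

      weight : V → ℕ
      weight a = ∑ℕ.sum λ i → nonzero (g i a)

    module _ {n} (g : Fin n → V → Carrier) (G : ∀ i → IsFunctional (g i)) where
      private
        wt = weight g

      ∑ᵛ-weight : ∑ᵛ wt ≡ n ℕ.* (r ℕ.* Q)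
      ∑ᵛ-weight = ≡.trans (∑ℕ.∑-comm {q ℕ.^ k} {n} λ m i → nonzero (g i (point m)))
        (≡.trans (∑ℕ.sum-cong-≗ {n} λ i → ∑ᵛ-nonzero (G i)) (∑-const n _))

      -- The square of a weight counts ordered pairs of nonzero coordinates. A pair (i, i)
      -- contributes exactly r Q, which after multiplication by q exceeds the general bound r² Q by
      -- r Q: one surplus per row.
      ∑ᵛ-weight² : n ℕ.* (n ℕ.* (r ℕ.* r ℕ.* Q) ℕ.+ r ℕ.* Q) ≤ q ℕ.* ∑ᵛ (λ a → wt a ℕ.* wt a)
      ∑ᵛ-weight² = begin
        n ℕ.* (n ℕ.* (r ℕ.* r ℕ.* Q) ℕ.+ r ℕ.* Q)       ≡⟨ ∑-const n _ ⟨
        ∑ℕ.sum {n} (const (n ℕ.* (r ℕ.* r ℕ.* Q) ℕ.+ r ℕ.* Q))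
          ≤⟨ ∑-mono {n} (λ i → ∑-lowerBound i (λ j → ∑ᵛ-nonzero² (G i) (G j)) (ℕ.≤-reflexive (diagonal i))) ⟩
        (∑ℕ.sum λ i → ∑ℕ.sum λ j → q ℕ.* ∑ᵛ (λ a → P i j a))      ≡⟨ ∑ℕ.sum-cong-≗ {n} (λ i → ∑ℕ.*-distribˡ-sum {n} q (λ j → ∑ᵛ (P i j))) ⟨
        (∑ℕ.sum λ i → q ℕ.* ∑ℕ.sum λ j → ∑ᵛ (λ a → P i j a))      ≡⟨ ∑ℕ.*-distribˡ-sum {n} q (λ i → ∑ℕ.sum λ j → ∑ᵛ (P i j)) ⟨
        q ℕ.* (∑ℕ.sum λ i → ∑ℕ.sum λ j → ∑ᵛ (λ a → P i j a))      ≡⟨ ≡.cong (q ℕ.*_) (∑ℕ.sum-cong-≗ {n} λ i → ∑ℕ.∑-comm {q ℕ.^ k} {n} λ m j → P i j (point m)) ⟨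
        q ℕ.* (∑ℕ.sum λ i → ∑ᵛ (λ a → ∑ℕ.sum λ j → P i j a))      ≡⟨ ≡.cong (q ℕ.*_) (∑ℕ.∑-comm {q ℕ.^ k} {n} λ m i → ∑ℕ.sum λ j → P i j (point m)) ⟨
        q ℕ.* ∑ᵛ (λ a → ∑ℕ.sum λ i → ∑ℕ.sum λ j → P i j a)        ≡⟨ ≡.cong (q ℕ.*_) (∑ℕ.sum-cong-≗ {q ℕ.^ k} (square ∘ point)) ⟨
        q ℕ.* ∑ᵛ (λ a → wt a ℕ.* wt a)                    ∎
        where
        open ℕ.≤-Reasoning
        P : Fin n → Fin n → V → ℕ
        P i j a = nonzero (g i a) ℕ.* nonzero (g j a)
        square : ∀ a → wt a ℕ.* wt a ≡ ∑ℕ.sum λ i → ∑ℕ.sum λ j → P i j a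
        square a = ≡.trans (∑ℕ.*-distribʳ-sum {n} (wt a) _)
          (∑ℕ.sum-cong-≗ {n} λ i → ∑ℕ.*-distribˡ-sum {n} (nonzero (g i a)) _)
        nonzero²≡nonzero : ∀ x → nonzero x ℕ.* nonzero x ≡ nonzero x
        nonzero²≡nonzero x with does (x ≟ 0#)
        ... | true  = ≡.refl
        ... | false = ≡.refl
        diagonal : ∀ i → r ℕ.* r ℕ.* Q ℕ.+ r ℕ.* Q ≡ q ℕ.* ∑ᵛ (P i i)
        diagonal i = begin-equality
          r ℕ.* r ℕ.* Q ℕ.+ r ℕ.* Q    ≡⟨ ≡.cong (ℕ._+ r ℕ.* Q) (ℕ.*-assoc r r Q) ⟩
          r ℕ.* (r ℕ.* Q) ℕ.+ r ℕ.* Q ≡⟨ ℕ.+-comm _ (r ℕ.* Q) ⟩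
          q ℕ.* (r ℕ.* Q)            ≡⟨ ≡.cong (q ℕ.*_) (∑ᵛ-nonzero (G i)) ⟨
          q ℕ.* ∑ᵛ (nonzero ∘ g i)   ≡⟨ ≡.cong (q ℕ.*_) (∑ℕ.sum-cong-≗ {q ℕ.^ k} λ m → nonzero²≡nonzero (g i (point m))) ⟨
          q ℕ.* ∑ᵛ (P i i)           ∎

-- Rational arithmetic

toℚᵘ-/ : ∀ i n → toℚᵘ (i / suc n) ℚᵘ.≃ mkℚᵘ i n
toℚᵘ-/ i n = ℚ.toℚᵘ-fromℚᵘ (mkℚᵘ i n)

/-mono-< : ∀ {i j m n} .{{_ : ℕ.NonZero m}} .{{_ : ℕ.NonZero n}} → i ℤ.* + n ℤ.< j ℤ.* + m → i / m ℚ.< j / n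
/-mono-< {i} {j} {suc m} {suc n} i*n<j*m = ℚ.toℚᵘ-cancel-<
  (ℚᵘ.<-respˡ-≃ (ℚᵘ.≃-sym (toℚᵘ-/ i m)) (ℚᵘ.<-respʳ-≃ (ℚᵘ.≃-sym (toℚᵘ-/ j n)) (*<* i*n<j*m)))

ι : ℤ → ℚ
ι i = i / 1

ι-+ : ∀ i j → ι (i ℤ.+ j) ≡ ι i ℚ.+ ι j
ι-+ i j = ℚ.toℚᵘ-injective (begin
  toℚᵘ (ι (i ℤ.+ j))             ≈⟨ toℚᵘ-/ (i ℤ.+ j) 0 ⟩
  mkℚᵘ (i ℤ.+ j) 0               ≈⟨ *≡* (solve 2 (λ i j →
    (i :+ j) :* con 1ℤ := (i :* con 1ℤ :+ j :* con 1ℤ) :* con 1ℤ) ≡.refl i j) ⟩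
  mkℚᵘ i 0 ℚᵘ.+ mkℚᵘ j 0         ≈⟨ ℚᵘ.+-cong (toℚᵘ-/ i 0) (toℚᵘ-/ j 0) ⟨
  toℚᵘ (ι i) ℚᵘ.+ toℚᵘ (ι j)     ≈⟨ ℚ.toℚᵘ-homo-+ (ι i) (ι j) ⟨
  toℚᵘ (ι i ℚ.+ ι j)             ∎)
  where
  open ℚᵘ.≃-Reasoning
  open ℤSolver.+-*-Solver

-- Taking `j` = 1 cancels a denominator, and taking `d` = 1 gives multiplicativity of `ι`.
/-*-ι : ∀ i d j .{{_ : ℕ.NonZero d}} → i / d ℚ.* ι (j ℤ.* + d) ≡ ι (i ℤ.* j)
/-*-ι i (suc d) j = ℚ.toℚᵘ-injective (begin
  toℚᵘ (i / suc d ℚ.* ι (j ℤ.* + suc d))           ≈⟨ ℚ.toℚᵘ-homo-* (i / suc d) (ι (j ℤ.* + suc d)) ⟩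
  toℚᵘ (i / suc d) ℚᵘ.* toℚᵘ (ι (j ℤ.* + suc d))   ≈⟨ ℚᵘ.*-cong (toℚᵘ-/ i d) (toℚᵘ-/ (j ℤ.* + suc d) 0) ⟩
  mkℚᵘ i d ℚᵘ.* mkℚᵘ (j ℤ.* + suc d) 0             ≈⟨ *≡* (≡.trans (solve 3 (λ i j d →
    i :* (j :* d) :* con 1ℤ := i :* j :* (d :* con 1ℤ)) ≡.refl i j (+ suc d)) (≡.cong (i ℤ.* j ℤ.*_) (≡.sym (ℤ.pos-* (suc d) 1)))) ⟩
  mkℚᵘ (i ℤ.* j) 0                                 ≈⟨ toℚᵘ-/ (i ℤ.* j) 0 ⟨
  toℚᵘ (ι (i ℤ.* j))                               ∎)
  where
  open ℚᵘ.≃-Reasoning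
  open ℤSolver.+-*-Solver

/-*-cancel : ∀ i d .{{_ : ℕ.NonZero d}} → i / d ℚ.* ι (+ d) ≡ ι i
/-*-cancel i d = ≡.trans (≡.cong (λ j → i / d ℚ.* ι j) (≡.sym (ℤ.*-identityˡ (+ d))))
  (≡.trans (/-*-ι i d 1ℤ) (≡.cong ι (ℤ.*-identityʳ i)))

ι-* : ∀ i j → ι (i ℤ.* j) ≡ ι i ℚ.* ι j
ι-* i j = ≡.trans (≡.sym (/-*-ι i 1 j)) (≡.cong (λ k → ι i ℚ.* ι k) (ℤ.*-identityʳ j))

ι-neg : ∀ i → ι (ℤ.- i) ≡ ℚ.- ι i
ι-neg i = ≡.trans (≡.cong ι (≡.sym (ℤ.-1*i≡-i i)))
  (≡.trans (ι-* (ℤ.- 1ℤ) i) (solve 1 (λ x → con (ℚ.- 1ℚ) :* x := :- x) ≡.refl (ι i)))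
  where open ℚSolver.+-*-Solver

ι-- : ∀ i j → ι (i ℤ.- j) ≡ ι i ℚ.- ι j
ι-- i j = ≡.trans (ι-+ i (ℤ.- j)) (≡.cong (ι i ℚ.+_) (ι-neg j))

ι-mono-≤ : ∀ {i j} → i ℤ.≤ j → ι i ℚ.≤ ι j
ι-mono-≤ {i} {j} i≤j = ℚ.toℚᵘ-cancel-≤
  (ℚᵘ.≤-respˡ-≃ (ℚᵘ.≃-sym (toℚᵘ-/ i 0)) (ℚᵘ.≤-respʳ-≃ (ℚᵘ.≃-sym (toℚᵘ-/ j 0))
    (*≤* (ℤ.*-monoʳ-≤-nonNeg 1ℤ i≤j))))

ι-positive : ∀ {i} → 0ℤ ℤ.< i → ℚ.Positive (ι i)
ι-positive {i} 0<i = ℚ.positive (/-mono-< {0ℤ} {i} {1} {1} (ℤ.*-monoʳ-<-pos 1ℤ 0<i))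

-- Clearing the denominator gives i ↧p ≤ ↥p < (⌊p⌋ + 1) ↧p, hence i < ⌊p⌋ + 1.
ι≤⇒≤floor : ∀ {i} p → ι i ℚ.≤ p → i ℤ.≤ floor p
ι≤⇒≤floor {i} p@record{} ι≤p = ℤ.≤-trans
  (≡.subst (i ℤ.≤_) (ℤ.pred-suc (ℚ.↥ p ℤ./ℕ ℚ.↧ₙ p)) (ℤ.i<j⇒i≤pred[j]
    (ℤ.*-cancelʳ-<-nonNeg {i} {ℤ.suc (ℚ.↥ p ℤ./ℕ ℚ.↧ₙ p)} (ℚ.↧ p) (ℤ.≤-<-trans i*↧p≤↥p (ℤ.n<s[n/ℕd]*d (ℚ.↥ p) (ℚ.↧ₙ p))))))
  (ℤ.≤-reflexive (≡.sym (ℤ.div-pos-is-/ℕ (ℚ.↥ p) (ℚ.↧ₙ p))))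
  where
  i*↧p≤↥p : i ℤ.* ℚ.↧ p ℤ.≤ ℚ.↥ p
  i*↧p≤↥p = ≡.subst (i ℤ.* ℚ.↧ p ℤ.≤_) (ℤ.*-identityʳ _)
    (ℚᵘ.drop-*≤* (ℚᵘ.≤-respˡ-≃ (toℚᵘ-/ i 0) (ℚ.toℚᵘ-mono-≤ ι≤p)))

-- These rewrite + e, for a polynomial expression e over ℕ, to the same expression over ℤ.
infixl 6 _⊞_
infixl 7 _⊠_

_⊞_ : ∀ {a b i j} → + a ≡ i → + b ≡ j → + (a ℕ.+ b) ≡ i ℤ.+ j
_⊞_ {a} {b} a≡i b≡j = ≡.trans (ℤ.pos-+ a b) (≡.cong₂ ℤ._+_ a≡i b≡j)

_⊠_ : ∀ {a b i j} → + a ≡ i → + b ≡ j → + (a ℕ.* b) ≡ i ℤ.* j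
_⊠_ {a} {b} a≡i b≡j = ≡.trans (ℤ.pos-* a b) (≡.cong₂ ℤ._*_ a≡i b≡j)

-- Here q = 1 + r, k = 1 + m and W = n - k + 1.
module Arithmetic
  {r m} (q-primePower : PrimePower (suc r)) (1≤k : 1 ≤ suc m) {n W d}
  (n≡W+m : n ≡ W ℕ.+ m)
  (average< : n ℕ.* (r ℕ.* suc r ℕ.^ m) < W ℕ.* (suc r ℕ.^ suc m ℕ.∸ 1))
  (variance : n ℕ.* (n ℕ.* (r ℕ.* r ℕ.* suc r ℕ.^ m) ℕ.+ r ℕ.* suc r ℕ.^ m)
                ℕ.+ suc r ℕ.* (suc r ℕ.^ suc m ℕ.* (d ℕ.* W))
            ≤ suc r ℕ.* ((W ℕ.+ d) ℕ.* (n ℕ.* (r ℕ.* suc r ℕ.^ m)) ℕ.+ d ℕ.* W))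
  (d-lowerBound : suc (m ℕ.* r) ≤ d)
  where
  Q = suc r ℕ.^ m
  N = suc r ℕ.^ suc m

  open Bounds q-primePower n 1≤k

  0<r : 0 < r
  0<r = ℕ.s≤s⁻¹ (primePower⇒1<q q-primePower)

  instance
    r≢0 : ℕ.NonZero r
    r≢0 = ℕ.>-nonZero 0<r
    q²≢0 : ℕ.NonZero (suc r ℕ.^ 2)
    q²≢0 = ℕ.m^n≢0 (suc r) 2

  nᶻ Wᶻ mᶻ rᶻ qᶻ Qᶻ dᶻ : ℤ
  nᶻ = + n
  Wᶻ = + W
  mᶻ = + m
  rᶻ = + r
  qᶻ = 1ℤ ℤ.+ rᶻ
  Qᶻ = + Q
  dᶻ = + d

  N≡ : + N ≡ qᶻ ℤ.* Qᶻ
  N≡ = ℤ.pos-* (suc r) Q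

  N∸1≡ : + (N ℕ.∸ 1) ≡ qᶻ ℤ.* Qᶻ ℤ.- 1ℤ
  N∸1≡ = ≡.trans (≡.sym (ℤ.⊖-≥ (ℕ.m^n>0 (suc r) (suc m)))) (≡.trans (≡.sym (ℤ.m-n≡m⊖n N 1)) (≡.cong (ℤ._- 1ℤ) N≡))

  n≡ : nᶻ ≡ Wᶻ ℤ.+ mᶻ
  n≡ = ≡.trans (≡.cong +_ n≡W+m) (ℤ.pos-+ W m)

  Dᶻ : ℤ
  Dᶻ = nᶻ ℤ.* (Qᶻ ℤ.- 1ℤ) ℤ.- mᶻ ℤ.* (+ N ℤ.- 1ℤ)

  -- The denominator of the distance bound is q^k - 1 times the gap between W and the average
  -- weight, so its positivity is the first inequality of the theorem.
  D≡ : Dᶻ ≡ Wᶻ ℤ.* (qᶻ ℤ.* Qᶻ ℤ.- 1ℤ) ℤ.- nᶻ ℤ.* (rᶻ ℤ.* Qᶻ)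
  D≡ = identity Wᶻ mᶻ rᶻ Qᶻ n≡ N≡
    where
    open ℤSolver.+-*-Solver
    -- The dependent quantities enter through equations; matching these with `refl` leaves a
    -- polynomial identity in independent variables. The later `identity` lemmas follow the same
    -- pattern.
    identity : ∀ W m r Q {n N} → n ≡ W ℤ.+ m → N ≡ (1ℤ ℤ.+ r) ℤ.* Q →
      n ℤ.* (Q ℤ.- 1ℤ) ℤ.- m ℤ.* (N ℤ.- 1ℤ) ≡ W ℤ.* ((1ℤ ℤ.+ r) ℤ.* Q ℤ.- 1ℤ) ℤ.- n ℤ.* (r ℤ.* Q)
    identity W m r Q ≡.refl ≡.refl = solve 4 (λ W m r Q → let n = W :+ m; q = con 1ℤ :+ r in
      n :* (Q :- con 1ℤ) :- m :* (q :* Q :- con 1ℤ)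
      := W :* (q :* Q :- con 1ℤ) :- n :* (r :* Q)) ≡.refl W m r Q

  average<ᶻ : nᶻ ℤ.* (rᶻ ℤ.* Qᶻ) ℤ.< Wᶻ ℤ.* (qᶻ ℤ.* Qᶻ ℤ.- 1ℤ)
  average<ᶻ = ≡.subst₂ ℤ._<_ (≡.refl {x = nᶻ} ⊠ (≡.refl {x = rᶻ} ⊠ ≡.refl {x = Qᶻ})) (≡.refl {x = Wᶻ} ⊠ N∸1≡) (+<+ average<)

  0<D : 0ℤ ℤ.< Dᶻ
  0<D = ≡.subst₂ ℤ._<_ (ℤ.+-inverseʳ (nᶻ ℤ.* (rᶻ ℤ.* Qᶻ))) (≡.sym D≡)
    (ℤ.+-monoˡ-< (ℤ.- (nᶻ ℤ.* (rᶻ ℤ.* Qᶻ))) average<ᶻ)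

  -- The difference of the two sides of `variance` is identically the difference of the two sides
  -- here. The extra factor q on the left keeps everything integral: it turns the q^(k-2) of the
  -- numerator into q^(k-1).
  dD≤ : dᶻ ℤ.* Dᶻ ℤ.* qᶻ ℤ.≤ nᶻ ℤ.* rᶻ ℤ.* Qᶻ ℤ.* (nᶻ ℤ.- 1ℤ ℤ.- qᶻ ℤ.* mᶻ)
  dD≤ = ℤ.0≤i-j⇒j≤i (≡.subst (0ℤ ℤ.≤_) (identity Wᶻ mᶻ rᶻ Qᶻ dᶻ n≡ D≡) (ℤ.i≤j⇒0≤j-i varianceᶻ))
    where
    open ℤSolver.+-*-Solver
    n̂ = ≡.refl {x = nᶻ}; Ŵ = ≡.refl {x = Wᶻ}; r̂ = ≡.refl {x = rᶻ}; Q̂ = ≡.refl {x = Qᶻ}; d̂ = ≡.refl {x = dᶻ}; q̂ = ≡.refl {x = qᶻ}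
    lhs = nᶻ ℤ.* (nᶻ ℤ.* (rᶻ ℤ.* rᶻ ℤ.* Qᶻ) ℤ.+ rᶻ ℤ.* Qᶻ) ℤ.+ qᶻ ℤ.* (qᶻ ℤ.* Qᶻ ℤ.* (dᶻ ℤ.* Wᶻ))
    rhs = qᶻ ℤ.* ((Wᶻ ℤ.+ dᶻ) ℤ.* (nᶻ ℤ.* (rᶻ ℤ.* Qᶻ)) ℤ.+ dᶻ ℤ.* Wᶻ)
    varianceᶻ : lhs ℤ.≤ rhs
    varianceᶻ = ≡.subst₂ ℤ._≤_
      (n̂ ⊠ (n̂ ⊠ (r̂ ⊠ r̂ ⊠ Q̂) ⊞ r̂ ⊠ Q̂) ⊞ q̂ ⊠ (N≡ ⊠ (d̂ ⊠ Ŵ)))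
      (q̂ ⊠ ((Ŵ ⊞ d̂) ⊠ (n̂ ⊠ (r̂ ⊠ Q̂)) ⊞ d̂ ⊠ Ŵ))
      (+≤+ variance)
    identity : ∀ W m r Q d {n D} → n ≡ W ℤ.+ m → D ≡ W ℤ.* ((1ℤ ℤ.+ r) ℤ.* Q ℤ.- 1ℤ) ℤ.- n ℤ.* (r ℤ.* Q) →
      let q = 1ℤ ℤ.+ r in
      q ℤ.* ((W ℤ.+ d) ℤ.* (n ℤ.* (r ℤ.* Q)) ℤ.+ d ℤ.* W)
        ℤ.- (n ℤ.* (n ℤ.* (r ℤ.* r ℤ.* Q) ℤ.+ r ℤ.* Q) ℤ.+ q ℤ.* (q ℤ.* Q ℤ.* (d ℤ.* W)))
      ≡ n ℤ.* r ℤ.* Q ℤ.* (n ℤ.- 1ℤ ℤ.- q ℤ.* m) ℤ.- d ℤ.* D ℤ.* q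
    identity W m r Q d ≡.refl ≡.refl = solve 5 (λ W m r Q d → let n = W :+ m; q = con 1ℤ :+ r in
      q :* ((W :+ d) :* (n :* (r :* Q)) :+ d :* W)
        :- (n :* (n :* (r :* r :* Q) :+ r :* Q) :+ q :* (q :* Q :* (d :* W)))
      := n :* r :* Q :* (n :- con 1ℤ :- q :* m) :- d :* (W :* (q :* Q :- con 1ℤ) :- n :* (r :* Q)) :* q)
      ≡.refl W m r Q d

  averageWeight< : averageWeight ℚ.< (nᶻ ℤ.- + suc m ℤ.+ + 1) / 1
  averageWeight< = /-mono-< {nᶻ ℤ.* (+ N ℤ.- Qᶻ)} {nᶻ ℤ.- + suc m ℤ.+ + 1} {N ℕ.∸ 1} {1} {{_}} {{_}} (≡.subst₂ ℤ._<_
    (lhs nᶻ rᶻ Qᶻ N≡) (rhs Wᶻ mᶻ _ n≡ N∸1≡) average<ᶻ)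
    where
    open ℤSolver.+-*-Solver
    lhs : ∀ n r Q {N} → N ≡ (1ℤ ℤ.+ r) ℤ.* Q → n ℤ.* (r ℤ.* Q) ≡ n ℤ.* (N ℤ.- Q) ℤ.* 1ℤ
    lhs n r Q ≡.refl = solve 3 (λ n r Q →
      n :* (r :* Q) := n :* ((con 1ℤ :+ r) :* Q :- Q) :* con 1ℤ) ≡.refl n r Q
    rhs : ∀ W m x {n y} → n ≡ W ℤ.+ m → y ≡ x → W ℤ.* x ≡ (n ℤ.- (1ℤ ℤ.+ m) ℤ.+ 1ℤ) ℤ.* y
    rhs W m x ≡.refl ≡.refl = solve 3 (λ W m x →
      W :* x := (W :+ m :- (con 1ℤ :+ m) :+ con 1ℤ) :* x) ≡.refl W m x

  distanceDenominator≡ : distanceDenominator ≡ ι Dᶻ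
  distanceDenominator≡ = ≡.sym (≡.trans (ι-- (nᶻ ℤ.* (Qᶻ ℤ.- 1ℤ)) (mᶻ ℤ.* (+ N ℤ.- 1ℤ))) (≡.cong₂ ℚ._-_
    (≡.trans (ι-* nᶻ (Qᶻ ℤ.- 1ℤ)) (≡.cong (n′ ℚ.*_) (ι-- Qᶻ 1ℤ)))
    (≡.trans (ι-* mᶻ (+ N ℤ.- 1ℤ)) (≡.cong (k-1 ℚ.*_) (ι-- (+ N) 1ℤ)))))

  instance
    D-positive : ℚ.Positive distanceDenominator
    D-positive = ≡.subst ℚ.Positive (≡.sym distanceDenominator≡) (ι-positive 0<D)
    D-nonZero : ℚ.NonZero distanceDenominator
    D-nonZero = ℚ.pos⇒nonZero distanceDenominator
    q-positive : ℚ.Positive q′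
    q-positive = ι-positive {+ suc r} (+<+ (s≤s z≤n))
    r-positive : ℚ.Positive (ι rᶻ)
    r-positive = ι-positive (+<+ 0<r)

  q′≡ : q′ ≡ 1ℚ ℚ.+ ι rᶻ
  q′≡ = ι-+ 1ℤ rᶻ

  qᵏ≡ : qᵏ ≡ q′ ℚ.* qᵏ⁻¹
  qᵏ≡ = ≡.trans (≡.cong ι N≡) (ι-* qᶻ Qᶻ)

  -- Since `qᵏ⁻²` is the fraction q^k / q², both sides become q^k after multiplication by q, also
  -- for k = 1; the positive factor q is then cancelled.
  qᵏ⁻¹≡ : qᵏ⁻¹ ≡ qᵏ⁻² ℚ.* q′
  qᵏ⁻¹≡ = ℚ.≤-antisym
    (ℚ.*-cancelʳ-≤-pos q′ (ℚ.≤-reflexive eq)) (ℚ.*-cancelʳ-≤-pos q′ (ℚ.≤-reflexive (≡.sym eq)))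
    where
    open ≡.≡-Reasoning
    eq : qᵏ⁻¹ ℚ.* q′ ≡ qᵏ⁻² ℚ.* q′ ℚ.* q′
    eq = begin
      qᵏ⁻¹ ℚ.* q′                              ≡⟨ ℚ.*-comm qᵏ⁻¹ q′ ⟩
      q′ ℚ.* qᵏ⁻¹                              ≡⟨ qᵏ≡ ⟨
      qᵏ                                       ≡⟨ /-*-cancel (+ N) (suc r ℕ.^ 2) ⟨
      qᵏ⁻² ℚ.* ι (+ (suc r ℕ.* (suc r ℕ.* 1))) ≡⟨ ≡.cong (qᵏ⁻² ℚ.*_) (≡.cong ι (≡.trans (ℤ.pos-* (suc r) (suc r ℕ.* 1)) (≡.cong (λ x → qᶻ ℤ.* + x) (ℕ.*-identityʳ (suc r))))) ⟩
      qᵏ⁻² ℚ.* ι (qᶻ ℤ.* qᶻ)                   ≡⟨ ≡.cong (qᵏ⁻² ℚ.*_) (ι-* qᶻ qᶻ) ⟩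
      qᵏ⁻² ℚ.* (q′ ℚ.* q′)                     ≡⟨ ℚ.*-assoc qᵏ⁻² q′ q′ ⟨
      qᵏ⁻² ℚ.* q′ ℚ.* q′                       ∎

  distance*denominator≤numerator : ι dᶻ ℚ.* distanceDenominator ℚ.≤ distanceNumerator
  distance*denominator≤numerator = ℚ.*-cancelʳ-≤-pos q′ (≡.subst₂ ℚ._≤_ lhs rhs (ι-mono-≤ dD≤))
    where
    lhs : ι (dᶻ ℤ.* Dᶻ ℤ.* qᶻ) ≡ ι dᶻ ℚ.* distanceDenominator ℚ.* q′
    lhs = ≡.trans (ι-* (dᶻ ℤ.* Dᶻ) qᶻ) (≡.cong (ℚ._* q′) (≡.trans (ι-* dᶻ Dᶻ) (≡.cong (ι dᶻ ℚ.*_) (≡.sym distanceDenominator≡))))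
    identity : ∀ n r κ x {q Q} → q ≡ 1ℚ ℚ.+ r → Q ≡ κ ℚ.* q →
      n ℚ.* r ℚ.* Q ℚ.* x ≡ n ℚ.* (q ℚ.- 1ℚ) ℚ.* κ ℚ.* x ℚ.* q
    identity n r κ x ≡.refl ≡.refl = solve 4 (λ n r κ x → let q = con 1ℚ :+ r in
      n :* r :* (κ :* q) :* x := n :* (q :- con 1ℚ) :* κ :* x :* q) ≡.refl n r κ x
      where open ℚSolver.+-*-Solver
    rhs : ι (nᶻ ℤ.* rᶻ ℤ.* Qᶻ ℤ.* (nᶻ ℤ.- 1ℤ ℤ.- qᶻ ℤ.* mᶻ)) ≡ distanceNumerator ℚ.* q′
    rhs = ≡.trans (ι-* (nᶻ ℤ.* rᶻ ℤ.* Qᶻ) (nᶻ ℤ.- 1ℤ ℤ.- qᶻ ℤ.* mᶻ)) (≡.trans (≡.cong₂ ℚ._*_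
      (≡.trans (ι-* (nᶻ ℤ.* rᶻ) Qᶻ) (≡.cong (ℚ._* qᵏ⁻¹) (ι-* nᶻ rᶻ)))
      (≡.trans (ι-- (nᶻ ℤ.- 1ℤ) (qᶻ ℤ.* mᶻ)) (≡.cong₂ ℚ._-_ (ι-- nᶻ 1ℤ) (ι-* qᶻ mᶻ))))
      (identity n′ (ι rᶻ) qᵏ⁻² _ q′≡ qᵏ⁻¹≡))

  distance≤ : + d ℤ.≤ floor (distanceNumerator ÷ distanceDenominator)
  distance≤ = ι≤⇒≤floor (distanceNumerator ÷ distanceDenominator) (begin
    ι dᶻ                                                              ≡⟨ ℚ.*-identityʳ _ ⟨
    ι dᶻ ℚ.* 1ℚ                                                       ≡⟨ ≡.cong (ι dᶻ ℚ.*_) (ℚ.*-inverseʳ distanceDenominator) ⟨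
    ι dᶻ ℚ.* (distanceDenominator ℚ.* ℚ.1/ distanceDenominator)       ≡⟨ ℚ.*-assoc (ι dᶻ) _ _ ⟨
    ι dᶻ ℚ.* distanceDenominator ℚ.* ℚ.1/ distanceDenominator         ≤⟨ ℚ.*-monoʳ-≤-nonNeg (ℚ.1/ distanceDenominator)
                                                                          {{ℚ.pos⇒nonNeg (ℚ.1/ distanceDenominator) {{ℚ.1/pos⇒pos distanceDenominator}}}} distance*denominator≤numerator ⟩
    distanceNumerator ℚ.* ℚ.1/ distanceDenominator                    ∎)
    where open ℚ.≤-Reasoning

  -- Multiplied by r = q - 1, which clears the fractions in `B` and `C`, the quadratic is exactly
  -- the numerator minus δ times the denominator, where δ = 1 + (k - 1)(q - 1) is the lower bound
  -- for d.
  quadratic≥0 : 0ℚ ℚ.≤ qᵏ⁻² ℚ.* (n′ ℚ.* n′) ℚ.- B ℚ.* n′ ℚ.+ C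
  quadratic≥0 = ℚ.*-cancelˡ-≤-pos (ι rᶻ) (begin
    ι rᶻ ℚ.* 0ℚ                                               ≡⟨ ℚ.*-zeroʳ (ι rᶻ) ⟩
    0ℚ                                                        ≡⟨ ℚ.+-inverseʳ (δ ℚ.* distanceDenominator) ⟨
    δ ℚ.* distanceDenominator ℚ.- δ ℚ.* distanceDenominator   ≤⟨ ℚ.+-monoˡ-≤ (ℚ.- (δ ℚ.* distanceDenominator)) (ℚ.≤-trans
        (ℚ.*-monoʳ-≤-nonNeg distanceDenominator {{ℚ.pos⇒nonNeg distanceDenominator}} δ≤d) distance*denominator≤numerator) ⟩
    distanceNumerator ℚ.- δ ℚ.* distanceDenominator           ≡⟨ identity n′ k-1 qᵏ⁻² (ι rᶻ) β γ q′≡ qᵏ⁻¹≡ qᵏ≡ β≡ γ≡ ⟨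
    ι rᶻ ℚ.* (qᵏ⁻² ℚ.* (n′ ℚ.* n′) ℚ.- B ℚ.* n′ ℚ.+ C)        ∎)
    where
    open ℚ.≤-Reasoning
    β γ δ : ℚ
    β = (Qᶻ ℤ.- 1ℤ) / r
    γ = (mᶻ ℤ.* (+ N ℤ.- 1ℤ)) / r
    δ = 1ℚ ℚ.+ k-1 ℚ.* ι rᶻ
    β≡ : β ℚ.* ι rᶻ ≡ qᵏ⁻¹ ℚ.- 1ℚ
    β≡ = ≡.trans (/-*-cancel (Qᶻ ℤ.- 1ℤ) r) (ι-- Qᶻ 1ℤ)
    γ≡ : γ ℚ.* ι rᶻ ≡ k-1 ℚ.* (qᵏ ℚ.- 1ℚ)
    γ≡ = ≡.trans (/-*-cancel (mᶻ ℤ.* (+ N ℤ.- 1ℤ)) r) (≡.trans (ι-* mᶻ (+ N ℤ.- 1ℤ)) (≡.cong (k-1 ℚ.*_) (ι-- (+ N) 1ℤ)))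
    δ≤d : δ ℚ.≤ ι dᶻ
    δ≤d = ≡.subst (ℚ._≤ ι dᶻ) (≡.trans (≡.cong ι (≡.refl {x = 1ℤ} ⊞ (≡.refl {x = mᶻ} ⊠ ≡.refl {x = rᶻ})))
      (≡.trans (ι-+ 1ℤ (mᶻ ℤ.* rᶻ)) (≡.cong (1ℚ ℚ.+_) (ι-* mᶻ rᶻ)))) (ι-mono-≤ (+≤+ d-lowerBound))
    identity : ∀ n m κ r β γ {q Q P} → q ≡ 1ℚ ℚ.+ r → Q ≡ κ ℚ.* q → P ≡ q ℚ.* Q →
      β ℚ.* r ≡ Q ℚ.- 1ℚ → γ ℚ.* r ≡ m ℚ.* (P ℚ.- 1ℚ) →
      r ℚ.* (κ ℚ.* (n ℚ.* n) ℚ.- (κ ℚ.+ m ℚ.* (+ 2 / 1 ℚ.* Q ℚ.- 1ℚ) ℚ.+ β) ℚ.* n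
        ℚ.+ (m ℚ.* m ℚ.* (P ℚ.- 1ℚ) ℚ.+ γ))
      ≡ n ℚ.* (q ℚ.- 1ℚ) ℚ.* κ ℚ.* (n ℚ.- 1ℚ ℚ.- q ℚ.* m)
        ℚ.- (1ℚ ℚ.+ m ℚ.* r) ℚ.* (n ℚ.* (Q ℚ.- 1ℚ) ℚ.- m ℚ.* (P ℚ.- 1ℚ))
    identity n m κ r β γ {Q = Q} {P} ≡.refl ≡.refl ≡.refl βr γr = begin-equality
      -- The fractions β and γ are known only through β r and γ r, so these products are isolated
      -- before being replaced.
      _ ≡⟨ solve 8 (λ n m κ r β γ Q P →
        r :* (κ :* (n :* n) :- (κ :+ m :* (con (+ 2 / 1) :* Q :- con 1ℚ) :+ β) :* n
          :+ (m :* m :* (P :- con 1ℚ) :+ γ))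
        := r :* (κ :* (n :* n) :- (κ :+ m :* (con (+ 2 / 1) :* Q :- con 1ℚ)) :* n
          :+ m :* m :* (P :- con 1ℚ)) :- β :* r :* n :+ γ :* r) ≡.refl n m κ r β γ Q P ⟩
      _ ≡⟨ ≡.cong₂ (λ x y → r ℚ.* (κ ℚ.* (n ℚ.* n) ℚ.- (κ ℚ.+ m ℚ.* (+ 2 / 1 ℚ.* Q ℚ.- 1ℚ)) ℚ.* n
          ℚ.+ m ℚ.* m ℚ.* (P ℚ.- 1ℚ)) ℚ.- x ℚ.* n ℚ.+ y) βr γr ⟩
      _ ≡⟨ solve 4 (λ n m κ r → let q = con 1ℚ :+ r; Q = κ :* q; P = q :* Q in
        r :* (κ :* (n :* n) :- (κ :+ m :* (con (+ 2 / 1) :* Q :- con 1ℚ)) :* n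
          :+ m :* m :* (P :- con 1ℚ)) :- (Q :- con 1ℚ) :* n :+ m :* (P :- con 1ℚ)
        := n :* (q :- con 1ℚ) :* κ :* (n :- con 1ℚ :- q :* m)
          :- (con 1ℚ :+ m :* r) :* (n :* (Q :- con 1ℚ) :- m :* (P :- con 1ℚ))) ≡.refl n m κ r ⟩
      _ ∎
      where open ℚSolver.+-*-Solver

-- Minimal codes

∣tabulate∣ : ∀ {n} (f : Fin n → Bool) → ∣ tabulate f ∣ ≡ ∑ℕ.sum λ i → if f i then 1 else 0
∣tabulate∣ {zero}  f = ≡.refl
∣tabulate∣ {suc n} f with f zero
... | true  = ≡.cong suc (∣tabulate∣ (f ∘ suc))
... | false = ∣tabulate∣ (f ∘ suc)

elements : ∀ {n} → Subset n → List (Fin n)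
elements []            = []
elements (inside  ∷ p) = zero ∷ List.map suc (elements p)
elements (outside ∷ p) = List.map suc (elements p)

length-elements : ∀ {n} (p : Subset n) → length (elements p) ≡ ∣ p ∣
length-elements []            = ≡.refl
length-elements (inside  ∷ p) = ≡.cong suc (≡.trans (List.length-map suc (elements p)) (length-elements p))
length-elements (outside ∷ p) = ≡.trans (List.length-map suc (elements p)) (length-elements p)

∈-elements⁺ : ∀ {n i} {p : Subset n} → i Subset.∈ p → i List.∈ elements p
∈-elements⁺ Vec.here                                = here ≡.refl
∈-elements⁺ {p = inside  ∷ p} (Vec.there i∈p) = there (List.∈-map⁺ suc (∈-elements⁺ i∈p))
∈-elements⁺ {p = outside ∷ p} (Vec.there i∈p) = List.∈-map⁺ suc (∈-elements⁺ i∈p)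

∈-elements⁻ : ∀ {n i} (p : Subset n) → i List.∈ elements p → i Subset.∈ p
∈-elements⁻ (inside ∷ p)  (here ≡.refl) = Vec.here
∈-elements⁻ (inside ∷ p)  (there i∈) with List.∈-map⁻ suc i∈
... | _ , j∈ , ≡.refl = Vec.there (∈-elements⁻ p j∈)
∈-elements⁻ (outside ∷ p) i∈ with List.∈-map⁻ suc i∈
... | _ , j∈ , ≡.refl = Vec.there (∈-elements⁻ p j∈)

module MinimalCode {c ℓ₁ ℓ₂ p r m n} (F : FiniteField (suc r) c ℓ₁ ℓ₂)
  (𝒞 : Pred (Vector (FiniteField.Carrier F) n) p) (isSubspace : Coding.IsSubspace F 𝒞)
  {b : Vector (Vector (FiniteField.Carrier F) n) (suc m)} (isBasis : Coding.IsBasis F 𝒞 b)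
  (nondegenerate : Coding.Nondegenerate F 𝒞) (minimalCode : Coding.IsMinimalCode F 𝒞)
  (1<q : 1 < suc r) where

  open Coding F
  open CommutativeRing (FiniteField.commutativeRing F) hiding (zero)
  open FiniteFieldProperties (isFiniteField F) hiding (_≋_)
  open IsSubspace isSubspace
  open IsBasis isBasis
  open RingProperties ring using (-‿distribˡ-*; -‿distribʳ-*)

  k = suc m
  Q = suc r ℕ.^ m
  V = Vector Carrier k
  0ᵃ : V
  0ᵃ = const 0#

  codeword : V → Vector Carrier n
  codeword a = linearCombination a b

  codeword∈𝒞 : ∀ a → codeword a ∈ 𝒞
  codeword∈𝒞 a = closed a b members
    where
    closed : ∀ {k} a (b : Vector (Vector Carrier n) k) → (∀ j → b j ∈ 𝒞) → linearCombination a b ∈ 𝒞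
    closed {zero}  a b b∈ = 0-closed
    closed {suc k} a b b∈ = +-closed (*-closed (a zero) (b∈ zero)) (closed (a ∘ suc) (b ∘ suc) (b∈ ∘ suc))

  codeword≉0 : ∀ {a} → ¬ a ≋ 0ᵃ → ¬ codeword a ≋ 0ᵛ
  codeword≉0 a≉0 eq = a≉0 (independent _ eq)

  -- Nondegeneracy is a negated statement; a search through the finitely many basis vectors extracts
  -- a witness from it. If all of them vanish at `i`, so does their span.
  nonzeroColumn : ∀ i → ∃[ j ] ¬ b j i ≈ 0#
  nonzeroColumn i with Fin.any? (λ j → ¬? (b j i ≟ 0#))
  ... | yes (j , bⱼᵢ≉0) = j , bⱼᵢ≉0
  ... | no  ∄j = contradiction (i , λ v v∈𝒞 → let a , v≋ = spanning v∈𝒞 in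
      trans (v≋ i) (trans (sum-cong-≋ λ j → trans (*-congˡ (decidable-stable (b j i ≟ 0#) λ bⱼᵢ≉0 → ∄j (j , bⱼᵢ≉0))) (zeroʳ (a j)))
        (sum-replicate-zero k)))
    nondegenerate

  coordinate : Fin n → V → Carrier
  coordinate i a = codeword a i

  coordinate-functional : ∀ i → IsFunctional (coordinate i)
  coordinate-functional i = record
    { cong       = λ a≋a′ → sum-cong-≋ {k} λ j → *-congʳ {b j i} (a≋a′ j)
    ; additive   = λ a a′ → trans (sum-cong-≋ {k} λ j → distribʳ (b j i) (a j) (a′ j))
                     (∑-distrib-+ (λ j → a j * b j i) λ j → a′ j * b j i)
    -- The preimage of x is supported at an index j with b j i nonzero, and its entry there is x
    -- divided by b j i.
    ; surjective = λ x → let j , bⱼᵢ≉0 = nonzeroColumn i; y , bⱼᵢ*y≈1 = invertible bⱼᵢ≉0 in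
        spike j (x * y) 0# ,
        trans (sum-supportedAt +-commutativeMonoid (λ j′ → spike j (x * y) 0# j′ * b j′ i) j λ j′ j′≢j → trans (*-congʳ (reflexive (spike-off (x * y) 0# j′≢j))) (zeroˡ _))
        (trans (*-congʳ (reflexive (spike-at j (x * y) 0#)))
        (trans (*-assoc x y (b j i)) (trans (*-congˡ (trans (*-comm y (b j i)) bⱼᵢ*y≈1)) (*-identityʳ x))))
    }

  module Coordinate i = IsFunctional (coordinate-functional i)

  -- By pigeonhole, two coefficient vectors agree on the given positions.
  vanishingOn : ∀ (is : List (Fin n)) → length is < k → ∃[ a ] ¬ a ≋ 0ᵃ × (∀ {i} → i List.∈ is → codeword a i ≈ 0#)
  vanishingOn is len< =
    let x , y , x<y , eq = Fin.pigeonhole (ℕ.^-monoʳ-< (suc r) 1<q len<) restrict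
        a : V
        a j = point x j - point y j
    in a
    , (λ a≋0 → Fin.<⇒≢ x<y (≡.trans (≡.sym (Inverse.inverseˡ (V-enum k) {x} λ j → sym (x-y≈0⇒x≈y _ _ (a≋0 j))))
        (Inverse.strictlyInverseˡ (V-enum k) y)) )
    , λ {i} i∈ → Coordinate.shift i {a} {point y} (trans (Coordinate.cong i λ j → //-rightDividesˡ (point y j) (point x j))
        (≡.subst (λ i → codeword (point x) i ≈ codeword (point y) i) (≡.sym (Any.lookup-index i∈))
          (index-injective (≡.trans (≡.sym (Fin.finToFun-funToFin _ (Any.index i∈)))
            (≡.trans (≡.cong (λ f → finToFun f (Any.index i∈)) eq) (Fin.finToFun-funToFin _ (Any.index i∈)))))))
    where
    open GroupProperties +-group using (//-rightDividesˡ)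
    restrict : Fin (suc r ℕ.^ k) → Fin (suc r ℕ.^ length is)
    restrict x = funToFin λ t → index (codeword (point x) (List.lookup is t))

  ∈σ⁺ : ∀ {v : Vector Carrier n} {i} → ¬ v i ≈ 0# → i Subset.∈ σ v
  ∈σ⁺ {v} {i} vᵢ≉0 = Vec.lookup⇒[]= i (σ v) (≡.trans (Vec.lookup∘tabulate _ i) (Dec.dec-true (¬? (v i ≟ 0#)) vᵢ≉0))

  ∈σ⁻ : ∀ {v : Vector Carrier n} {i} → i Subset.∈ σ v → ¬ v i ≈ 0#
  ∈σ⁻ {v} {i} i∈σ vᵢ≈0 with () ← ≡.trans (≡.sym (Vec.[]=⇒lookup i∈σ))
    (≡.trans (Vec.lookup∘tabulate _ i) (Dec.dec-false (¬? (v i ≟ 0#)) λ vᵢ≉0 → vᵢ≉0 vᵢ≈0))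

  nonzeroEntry : ∀ {v : Vector Carrier n} → ¬ v ≋ 0ᵛ → ∃[ i ] ¬ v i ≈ 0#
  nonzeroEntry {v} v≉0 with Fin.any? (λ i → ¬? (v i ≟ 0#))
  ... | yes ∃i = ∃i
  ... | no  ∄i = contradiction (λ i → decidable-stable (v i ≟ 0#) λ vᵢ≉0 → ∄i (i , vᵢ≉0)) v≉0

  -- Bounds on the weight of a single codeword

  module _ {v} (v∈𝒞 : v ∈ 𝒞) (v≉0 : ¬ v ≋ 0ᵛ) where

    -- Otherwise some nonzero codeword vanishes off the support of v and at one
    -- point of it, contradicting minimality.
    weight-upperBound : ω v ℕ.+ m ≤ n
    weight-upperBound = ℕ.≮⇒≥ λ n<ω+m →
      let i₀ , vᵢ≉0 = nonzeroEntry v≉0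
          -- Fewer than m positions lie off the support; together with i₀ they are still fewer than
          -- k = m + 1.
          len< : suc (length (elements (∁ (σ v)))) < k
          len< = s≤s (≡.subst (_< m) (≡.sym (≡.trans (length-elements (∁ (σ v))) (Subset.∣∁p∣≡n∸∣p∣ (σ v))))
            (ℕ.m<n+o⇒m∸n<o n (ω v) {m} {{ℕ.>-nonZero (0<m n<ω+m)}} n<ω+m))
          a , a≉0 , vanish = vanishingOn (i₀ ∷ elements (∁ (σ v))) len<
          t , u≋tv = IsMinimalCodeword.minimal (minimalCode v∈𝒞 v≉0) (codeword∈𝒞 a) λ {i} i∈σu →
            decidable-stable (i Subset.∈? σ v) λ i∉σv →
              ∈σ⁻ {codeword a} i∈σu (vanish (there (∈-elements⁺ (Subset.x∉p⇒x∈∁p i∉σv))))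
          t≈0 : t ≈ 0#
          t≈0 = x*z≈y*z⇒z≈0 vᵢ≉0 (trans (*-comm (v i₀) t) (trans (sym (u≋tv i₀)) (trans (vanish (here ≡.refl)) (sym (zeroˡ t)))))
      in codeword≉0 a≉0 λ i → trans (u≋tv i) (trans (*-congʳ t≈0) (zeroˡ (v i)))
      where
      -- Needed because the subtraction n ∸ ω(v) is truncated: it is below m only if m is positive,
      -- which follows from ω(v) ≤ n.
      0<m : n < ω v ℕ.+ m → 0 < m
      0<m n<ω+m = ℕ.+-cancelˡ-< (ω v) 0 m (ℕ.≤-<-trans (≡.subst (_≤ n) (≡.sym (ℕ.+-identityʳ (ω v))) (Subset.∣p∣≤n (σ v))) n<ω+m)

    -- If u differs from v throughout σ(v), then σ(v) lies in the support of w = u - v, and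
    -- minimality of w gives v = t w. At i₀, where w equals -v, this forces t = -1; hence w = -v and
    -- u = 0.
    agreement : ∀ {u i₀} → u ∈ 𝒞 → ¬ u ≋ 0ᵛ → ¬ v i₀ ≈ 0# → u i₀ ≈ 0# → ∃[ i ] i Subset.∈ σ v × u i ≈ v i
    agreement {u} {i₀} u∈𝒞 u≉0 vᵢ≉0 uᵢ≈0 with Fin.any? (λ i → (i Subset.∈? σ v) Dec.×-dec (u i ≟ v i))
    ... | yes ∃i = ∃i
    ... | no  ∄i = contradiction u≋0 u≉0
      where
      -1*v : Vector Carrier n
      -1*v = (- 1#) *ᵛ v
      w : Vector Carrier n
      w = u +ᵛ -1*v
      w≈ : ∀ i → w i ≈ u i - v i
      w≈ i = +-congˡ (-1*x≈-x (v i))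
        where open RingProperties ring using (-1*x≈-x)
      w∈𝒞 : w ∈ 𝒞
      w∈𝒞 = +-closed u∈𝒞 (*-closed (- 1#) v∈𝒞)
      σv⊆σw : σ v ⊆ σ w
      σv⊆σw {i} i∈σv = ∈σ⁺ {w} λ wᵢ≈0 → ∄i (i , i∈σv , x-y≈0⇒x≈y _ _ (trans (sym (w≈ i)) wᵢ≈0))
      w≉0 : ¬ w ≋ 0ᵛ
      w≉0 w≋0 = ∈σ⁻ {w} (σv⊆σw (∈σ⁺ {v} vᵢ≉0)) (w≋0 i₀)
      v≋tw : ∃[ t ] v ≋ t *ᵛ w
      v≋tw = IsMinimalCodeword.minimal (minimalCode w∈𝒞 w≉0) v∈𝒞 σv⊆σw
      t = proj₁ v≋tw
      wᵢ≈-vᵢ : w i₀ ≈ - v i₀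
      wᵢ≈-vᵢ = trans (w≈ i₀) (trans (+-congʳ uᵢ≈0) (+-identityˡ _))
      -t≈1 : - t ≈ 1#
      -t≈1 = x-y≈0⇒x≈y _ _ (x*z≈y*z⇒z≈0 vᵢ≉0 (begin
        v i₀ * (- t - 1#)           ≈⟨ distribˡ _ _ _ ⟩
        v i₀ * - t + v i₀ * - 1#    ≈⟨ +-cong (trans (sym (-‿distribʳ-* _ _)) (trans (-‿distribˡ-* _ _) (*-comm _ _)))
                                          (trans (sym (-‿distribʳ-* _ _)) (-‿cong (*-identityʳ _))) ⟩
        t * - v i₀ - v i₀           ≈⟨ +-congʳ (*-congˡ wᵢ≈-vᵢ) ⟨
        t * w i₀ - v i₀             ≈⟨ +-congʳ (proj₂ v≋tw i₀) ⟨
        v i₀ - v i₀                 ≈⟨ -‿inverseʳ (v i₀) ⟩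
        0#                          ≈⟨ zeroˡ _ ⟨
        0# * (- t - 1#)             ∎))
        where open import Relation.Binary.Reasoning.Setoid setoid
      u≋0 : u ≋ 0ᵛ
      u≋0 i = begin
        u i                     ≈⟨ +-identityʳ _ ⟨
        u i + 0#                ≈⟨ +-congˡ (-‿inverseˡ (v i)) ⟨
        u i + (- v i + v i)     ≈⟨ +-assoc _ _ _ ⟨
        u i - v i + v i         ≈⟨ +-cong (sym (w≈ i)) (proj₂ v≋tw i) ⟩
        w i + t * w i           ≈⟨ +-congʳ (trans (sym (*-identityˡ _)) (*-congʳ (sym -t≈1))) ⟩
        - t * w i + t * w i     ≈⟨ distribʳ _ _ _ ⟨
        (- t + t) * w i         ≈⟨ *-congʳ (-‿inverseˡ t) ⟩
        0# * w i                ≈⟨ zeroˡ _ ⟩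
        0#                      ∎
        where open import Relation.Binary.Reasoning.Setoid setoid

    weight-lowerBound : suc (m ℕ.* r) ≤ ω v
    weight-lowerBound = go (elements (σ v)) ∈-elements⁺ (∈-elements⁻ (σ v)) (length-elements (σ v))
      where
      go : ∀ is → (∀ {i} → i Subset.∈ σ v → i List.∈ is) → (∀ {i} → i List.∈ is → i Subset.∈ σ v) →
        length is ≡ ω v → suc (m ℕ.* r) ≤ ω v
      go [] ∈⁺ _ _ with () ← ∈⁺ (∈σ⁺ {v} (proj₂ (nonzeroEntry v≉0)))
      -- The head of the list of support positions serves as i₀. The forms number r + (ω(v) - 1), at
      -- least k r = r + m r by Jamison's bound, and r is cancelled.
      go (i₀ ∷ is) ∈⁺ ∈⁻ ∣is∣≡ω = ≡.subst (suc (m ℕ.* r) ≤_) ∣is∣≡ω (s≤s (ℕ.+-cancelˡ-≤ r _ _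
        (≡.subst (k ℕ.* r ≤_) length-forms (affineForms-cover (forms₁ ++ forms₂) cover (All.++⁺ avoid₁ avoid₂)))))
        where
        form : Fin n → Carrier → AffineForm k
        form i t = (λ j → b j i) , - t
        forms₁ forms₂ : List (AffineForm k)
        forms₁ = List.map (λ i → form i (v i)) is
        forms₂ = List.map (λ s → form i₀ (nonzeroElement s)) (allFin r)
        length-forms : length (forms₁ ++ forms₂) ≡ r ℕ.+ length is
        length-forms = ≡.trans (List.length-++ forms₁) (≡.trans (≡.cong₂ ℕ._+_ (List.length-map _ is)
          (≡.trans (List.length-map _ (allFin r)) (List.length-tabulate {n = r} _))) (ℕ.+-comm (length is) r))
        form≉0 : ∀ i {t} → ¬ t ≈ 0# → ¬ ⟦ form i t ⟧ 0ᵃ ≈ 0#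
        form≉0 i t≉0 eq = t≉0 (-x≈0⇒x≈0 (trans (sym (trans (+-congʳ (Coordinate.g[0]≈0 i)) (+-identityˡ _))) eq))
        form≈0 : ∀ i {a t} → codeword a i ≈ t → ⟦ form i t ⟧ a ≈ 0#
        form≈0 i {t = t} eq = trans (+-congʳ eq) (-‿inverseʳ t)
        avoid₁ : All (λ L → ¬ ⟦ L ⟧ 0ᵃ ≈ 0#) forms₁
        avoid₁ = All.map⁺ (All.tabulate λ {i} i∈ → form≉0 i (∈σ⁻ {v} (∈⁻ (there i∈))))
        avoid₂ : All (λ L → ¬ ⟦ L ⟧ 0ᵃ ≈ 0#) forms₂
        avoid₂ = All.map⁺ (All.tabulate λ {s} _ → form≉0 i₀ (nonzeroElement≉0 s))
        vᵢ≉0 : ¬ v i₀ ≈ 0#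
        vᵢ≉0 = ∈σ⁻ {v} (∈⁻ (here ≡.refl))
        cover : ∀ a → ¬ a ≋ 0ᵃ → Any (λ L → ⟦ L ⟧ a ≈ 0#) (forms₁ ++ forms₂)
        cover a a≉0 with codeword a i₀ ≟ 0#
        ... | no  uᵢ≉0 = let s , eq = nonzeroElement-surjective uᵢ≉0 in
          Any.++⁺ʳ forms₁ (Any.map⁺ (List.lose (List.∈-allFin s) (form≈0 i₀ {a} (sym eq))))
        ... | yes uᵢ≈0 with agreement (codeword∈𝒞 a) (codeword≉0 a≉0) vᵢ≉0 uᵢ≈0
        ... | i , i∈σ , uᵢ≈vᵢ with ∈⁺ i∈σ
        -- The agreement cannot occur at i₀, where u is zero and v is not, so it occurs at a
        -- position that has a form in `forms₁`.
        ... | here ≡.refl = contradiction (trans (sym uᵢ≈vᵢ) uᵢ≈0) vᵢ≉0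
        ... | there i∈    = Any.++⁺ˡ (Any.map⁺ (List.lose i∈ (form≈0 i {a} uᵢ≈vᵢ)))

  -- Inequalities for the weight distribution of the code

  N = suc r ℕ.^ k

  origin : Fin N
  origin = Inverse.to (V-enum k) 0ᵃ

  point-origin : point origin ≋ 0ᵃ
  point-origin = Inverse.strictlyInverseʳ (V-enum k) 0ᵃ

  point≉0 : ∀ {x} → x ≢ origin → ¬ point x ≋ 0ᵃ
  point≉0 x≢origin x≋0 = x≢origin (≡.sym (Inverse.inverseˡ (V-enum k) λ j → sym (x≋0 j)))

  W : ℕ
  W = n ℕ.∸ m

  wt : Fin N → ℕ
  wt x = weight coordinate (point x)

  ω≡∑ : ∀ (v : Vector Carrier n) → ω v ≡ ∑ℕ.sum (nonzero ∘ v)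
  ω≡∑ v = ∣tabulate∣ λ i → does (¬? (v i ≟ 0#))

  nonzero-cong : ∀ {x y} → x ≈ y → nonzero x ≡ nonzero y
  nonzero-cong x≈y = 𝟙-cong (¬? (_ ≟ 0#)) (¬? (_ ≟ 0#)) (λ x≉0 y≈0 → x≉0 (trans x≈y y≈0)) (λ y≉0 x≈0 → y≉0 (trans (sym x≈y) x≈0))

  wt-origin : wt origin ≡ 0
  wt-origin = ≡.trans (∑ℕ.sum-cong-≗ {n} λ i →
    ≡.trans (nonzero-cong (trans (Coordinate.cong i point-origin) (Coordinate.g[0]≈0 i)))
      (𝟙-false (¬? (0# ≟ 0#)) λ 0≉0 → 0≉0 refl)) (∑ℕ.sum-replicate-zero n)

  wt-upperBound : m ≤ n → ∀ {x} → x ≢ origin → wt x ≤ W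
  wt-upperBound m≤n {x} x≢origin = ≡.subst (_≤ W) (ω≡∑ (codeword (point x)))
    (ℕ.m+n≤o⇒m≤o∸n _ (weight-upperBound (codeword∈𝒞 (point x)) (codeword≉0 (point≉0 x≢origin))))

  ω≡wt : ∀ {v : Vector Carrier n} → v ∈ 𝒞 → ¬ v ≋ 0ᵛ → ∃[ x ] x ≢ origin × ω v ≡ wt x
  ω≡wt {v} v∈𝒞 v≉0 =
    let a , v≋ = spanning v∈𝒞
        point≋a = Inverse.strictlyInverseʳ (V-enum k) a
    in Inverse.to (V-enum k) a
    , (λ x≡origin → v≉0 λ i → trans (v≋ i) (trans (Coordinate.cong i λ j → trans (sym (point≋a j))
        (≡.subst (λ x → point x j ≈ 0#) (≡.sym x≡origin) (point-origin j))) (Coordinate.g[0]≈0 i)))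
    , ≡.trans (ω≡∑ v) (∑ℕ.sum-cong-≗ {n} λ i → nonzero-cong (trans (v≋ i) (sym (Coordinate.cong i point≋a))))

  -- A correction term at the zero codeword: it lets pointwise bounds valid for nonzero codewords
  -- hold at all `N` points, so that sums always run over the whole space.
  atOrigin : Fin N → ℕ
  atOrigin x = 𝟙 (x Fin.≟ origin)

  ∑-atOrigin : ∀ t → ∑ℕ.sum (λ x → t ℕ.* atOrigin x) ≡ t
  ∑-atOrigin t = ≡.trans
    (sum-supportedAt ℕ.+-0-commutativeMonoid (λ x → t ℕ.* atOrigin x) origin
      λ x x≢origin → ≡.trans (≡.cong (t ℕ.*_) (𝟙-false (x Fin.≟ origin) x≢origin)) (ℕ.*-zeroʳ t))
    (≡.trans (≡.cong (t ℕ.*_) (𝟙-true (origin Fin.≟ origin) ≡.refl)) (ℕ.*-identityʳ t))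

  module _ (m≤n : m ≤ n) where

    -- If the total weight reached W (q^k - 1), the bound W on each of the q^k - 1 nonzero codewords
    -- would be attained by all of them, and the code would have constant weight.
    average< : ¬ ConstantWeight 𝒞 → n ℕ.* (r ℕ.* Q) < W ℕ.* (N ℕ.∸ 1)
    average< ¬constant = ℕ.≰⇒> λ W[N-1]≤ → ¬constant λ u∈𝒞 v∈𝒞 u≉0 v≉0 →
      let x , x≢origin , ωu≡ = ω≡wt u∈𝒞 u≉0
          y , y≢origin , ωv≡ = ω≡wt v∈𝒞 v≉0
          maximal = ∑-mono-tight {N} bound (total W[N-1]≤)
      in ≡.trans ωu≡ (≡.trans (wt≡W maximal x≢origin) (≡.sym (≡.trans ωv≡ (wt≡W maximal y≢origin))))
      where
      bound : ∀ x → wt x ℕ.+ W ℕ.* atOrigin x ≤ W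
      bound x with x Fin.≟ origin
      ... | yes ≡.refl = ℕ.≤-reflexive (≡.cong₂ ℕ._+_ wt-origin (ℕ.*-identityʳ W))
      ... | no  x≢origin = ≡.subst (_≤ W) (≡.sym (≡.trans (≡.cong (wt x ℕ.+_) (ℕ.*-zeroʳ W)) (ℕ.+-identityʳ (wt x))))
        (wt-upperBound m≤n x≢origin)
      wt≡W : (∀ x → wt x ℕ.+ W ℕ.* atOrigin x ≡ W) → ∀ {x} → x ≢ origin → wt x ≡ W
      wt≡W maximal {x} x≢origin = ≡.trans (≡.sym (≡.trans
        (≡.cong (λ t → wt x ℕ.+ W ℕ.* t) (𝟙-false (x Fin.≟ origin) x≢origin))
        (≡.trans (≡.cong (wt x ℕ.+_) (ℕ.*-zeroʳ W)) (ℕ.+-identityʳ (wt x))))) (maximal x)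
      total : W ℕ.* (N ℕ.∸ 1) ≤ n ℕ.* (r ℕ.* Q) → ∑ℕ.sum {N} (const W) ≤ ∑ℕ.sum (λ x → wt x ℕ.+ W ℕ.* atOrigin x)
      total W[N-1]≤ = begin
        ∑ℕ.sum {N} (const W)                            ≡⟨ ∑-const N W ⟩
        N ℕ.* W                                         ≡⟨ ≡.cong (ℕ._* W) (ℕ.m+[n∸m]≡n (ℕ.m^n>0 (suc r) k)) ⟨
        W ℕ.+ (N ℕ.∸ 1) ℕ.* W                           ≡⟨ ≡.cong (W ℕ.+_) (ℕ.*-comm (N ℕ.∸ 1) W) ⟩
        W ℕ.+ W ℕ.* (N ℕ.∸ 1)                           ≤⟨ ℕ.+-monoʳ-≤ W W[N-1]≤ ⟩
        W ℕ.+ n ℕ.* (r ℕ.* Q)                           ≡⟨ ℕ.+-comm W _ ⟩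
        n ℕ.* (r ℕ.* Q) ℕ.+ W                           ≡⟨ ≡.cong₂ ℕ._+_ (∑ᵛ-weight coordinate coordinate-functional) (∑-atOrigin W) ⟨
        ∑ℕ.sum wt ℕ.+ ∑ℕ.sum (λ x → W ℕ.* atOrigin x)   ≡⟨ ∑ℕ.∑-distrib-+ {N} wt (λ x → W ℕ.* atOrigin x) ⟨
        ∑ℕ.sum (λ x → wt x ℕ.+ W ℕ.* atOrigin x)        ∎
        where open ℕ.≤-Reasoning

    -- (W - wt)(wt - d) ≥ 0 off the origin, summed over the whole code.
    variance : ∀ {d} → (∀ {v : Vector Carrier n} → v ∈ 𝒞 → ¬ v ≋ 0ᵛ → d ≤ ω v) →
      n ℕ.* (n ℕ.* (r ℕ.* r ℕ.* Q) ℕ.+ r ℕ.* Q) ℕ.+ suc r ℕ.* (N ℕ.* (d ℕ.* W))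
      ≤ suc r ℕ.* ((W ℕ.+ d) ℕ.* (n ℕ.* (r ℕ.* Q)) ℕ.+ d ℕ.* W)
    variance {d} d≤ω = begin
      n ℕ.* (n ℕ.* (r ℕ.* r ℕ.* Q) ℕ.+ r ℕ.* Q) ℕ.+ suc r ℕ.* (N ℕ.* (d ℕ.* W))
        ≤⟨ ℕ.+-monoˡ-≤ _ (∑ᵛ-weight² coordinate coordinate-functional) ⟩
      suc r ℕ.* ∑ℕ.sum (λ x → wt x ℕ.* wt x) ℕ.+ suc r ℕ.* (N ℕ.* (d ℕ.* W))
        ≡⟨ ℕ.*-distribˡ-+ (suc r) _ (N ℕ.* (d ℕ.* W)) ⟨
      suc r ℕ.* (∑ℕ.sum (λ x → wt x ℕ.* wt x) ℕ.+ N ℕ.* (d ℕ.* W))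
        ≤⟨ ℕ.*-monoʳ-≤ (suc r) total ⟩
      suc r ℕ.* ((W ℕ.+ d) ℕ.* (n ℕ.* (r ℕ.* Q)) ℕ.+ d ℕ.* W) ∎
      where
      open ℕ.≤-Reasoning
      -- This is (W - w)(w - d) ≥ 0 without subtraction: for w = d + x and W = w + y the two sides
      -- differ by x y.
      product : ∀ w → d ≤ w → w ≤ W → w ℕ.* w ℕ.+ d ℕ.* W ≤ (W ℕ.+ d) ℕ.* w
      product w d≤w w≤W = ≡.subst (λ W → w ℕ.* w ℕ.+ d ℕ.* W ≤ (W ℕ.+ d) ℕ.* w) (ℕ.m+[n∸m]≡n w≤W)
        (≡.subst (λ w → w ℕ.* w ℕ.+ d ℕ.* (w ℕ.+ y) ≤ (w ℕ.+ y ℕ.+ d) ℕ.* w) (ℕ.m+[n∸m]≡n d≤w)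
          (ℕ.m+n≤o⇒m≤o _ {x ℕ.* y} (ℕ.≤-reflexive (solve 3 (λ d x y → let w = d :+ x in
            w :* w :+ d :* (w :+ y) :+ x :* y := (w :+ y :+ d) :* w) ≡.refl d x y))))
        where
        open ℕSolver.+-*-Solver
        x = w ℕ.∸ d
        y = W ℕ.∸ w
      -- At the origin the weight is 0 and the product (W - 0)(0 - d) equals -d W; the last term
      -- compensates for exactly this.
      pointwise-bound : ∀ x → wt x ℕ.* wt x ℕ.+ d ℕ.* W ≤ (W ℕ.+ d) ℕ.* wt x ℕ.+ d ℕ.* W ℕ.* atOrigin x
      pointwise-bound x with x Fin.≟ origin
      ... | yes ≡.refl rewrite wt-origin = ℕ.≤-trans (ℕ.≤-reflexive (≡.sym (ℕ.*-identityʳ (d ℕ.* W)))) (ℕ.m≤n+m _ _)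
      ... | no  x≢origin = ℕ.≤-trans (product (wt x)
        (≡.subst (d ≤_) (ω≡∑ (codeword (point x))) (d≤ω (codeword∈𝒞 (point x)) (codeword≉0 (point≉0 x≢origin))))
        (wt-upperBound m≤n x≢origin)) (ℕ.m≤m+n _ _)
      total : ∑ℕ.sum (λ x → wt x ℕ.* wt x) ℕ.+ N ℕ.* (d ℕ.* W) ≤ (W ℕ.+ d) ℕ.* (n ℕ.* (r ℕ.* Q)) ℕ.+ d ℕ.* W
      total = begin
        ∑ℕ.sum (λ x → wt x ℕ.* wt x) ℕ.+ N ℕ.* (d ℕ.* W)
          ≡⟨ ≡.cong (∑ℕ.sum (λ x → wt x ℕ.* wt x) ℕ.+_) (∑-const N (d ℕ.* W)) ⟨
        ∑ℕ.sum (λ x → wt x ℕ.* wt x) ℕ.+ ∑ℕ.sum {N} (const (d ℕ.* W))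
          ≡⟨ ∑ℕ.∑-distrib-+ {N} (λ x → wt x ℕ.* wt x) (const (d ℕ.* W)) ⟨
        ∑ℕ.sum (λ x → wt x ℕ.* wt x ℕ.+ d ℕ.* W)
          ≤⟨ ∑-mono {N} pointwise-bound ⟩
        ∑ℕ.sum (λ x → (W ℕ.+ d) ℕ.* wt x ℕ.+ d ℕ.* W ℕ.* atOrigin x)
          ≡⟨ ∑ℕ.∑-distrib-+ {N} (λ x → (W ℕ.+ d) ℕ.* wt x) (λ x → d ℕ.* W ℕ.* atOrigin x) ⟩
        ∑ℕ.sum (λ x → (W ℕ.+ d) ℕ.* wt x) ℕ.+ ∑ℕ.sum (λ x → d ℕ.* W ℕ.* atOrigin x)
          ≡⟨ ≡.cong₂ ℕ._+_ (≡.trans (≡.sym (∑ℕ.*-distribˡ-sum {N} (W ℕ.+ d) wt))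
               (≡.cong ((W ℕ.+ d) ℕ.*_) (∑ᵛ-weight coordinate coordinate-functional))) (∑-atOrigin (d ℕ.* W)) ⟩
        (W ℕ.+ d) ℕ.* (n ℕ.* (r ℕ.* Q)) ℕ.+ d ℕ.* W ∎

corollary3p7 :
    ∀ {c ℓ₁ ℓ₂ p} (q : ℕ) (q-primePower : PrimePower q) (F : FiniteField q c ℓ₁ ℓ₂)
    (n k d : ℕ) (1≤k : 1 ≤ k) → k ≤ n →
    (𝒞 : Pred (Vector (FiniteField.Carrier F) n) p) →
    let open Coding F
        open Bounds q-primePower n 1≤k
    in
    IsCode 𝒞 k d → Nondegenerate 𝒞 → IsMinimalCode 𝒞 → ¬ ConstantWeight 𝒞 →
    (averageWeight ℚ.< (+ n ℤ.- + k ℤ.+ + 1) / 1)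
    × (Σ[ denominator≢0 ∈ ℚ.NonZero distanceDenominator ]
        + d ℤ.≤ floor ((distanceNumerator ÷ distanceDenominator) {{denominator≢0}}))
    × (0ℚ ℚ.≤ qᵏ⁻² ℚ.* (n′ ℚ.* n′) ℚ.- B ℚ.* n′ ℚ.+ C)
corollary3p7 zero q-primePower = contradiction (primePower⇒1<q q-primePower) λ ()
corollary3p7 (suc r) q-primePower F n (suc m) d 1≤k k≤n 𝒞 isCode nondegenerate minimalCode ¬constant =
  -- The witness that the quotient is defined comes from the first inequality, which makes the
  -- denominator positive.
  averageWeight< , (D-nonZero , distance≤) , quadratic≥0
  where
  open Coding F
  open IsCode isCode using (isSubspace; dimension; minimumDistance)
  open IsMinimumDistance minimumDistance
  open MinimalCode F 𝒞 isSubspace (proj₂ dimension) nondegenerate minimalCode (primePower⇒1<q q-primePower)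
  m≤n : m ≤ n
  m≤n = ℕ.<⇒≤ k≤n
  d-lowerBound : suc (m ℕ.* r) ≤ d
  d-lowerBound = let v , v∈𝒞 , v≉0 , ωv≡d = attained in
    ≡.subst (suc (m ℕ.* r) ≤_) ωv≡d (weight-lowerBound v∈𝒞 v≉0)
  open Arithmetic q-primePower 1≤k {W = W} (≡.sym (ℕ.m∸n+n≡m m≤n)) (average< m≤n ¬constant) (variance m≤n lowerBound) d-lowerBound
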